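{- A finite graph has cutwidth at most $2$ if and only if it is (isomorphic to) a subgraph of some chain of cycles.
   Context: All graphs are finite and simple. A graph with $n$ vertices has cutwidth at most $2$ if its vertices can be numbered $1,\ldots,n$ (bijectively) so that for every $i=1,\ldots,n-1$ there are at most two edges $(u,v)$ with $u\le i<v$. A chain of $n$ cycles is a union of $n$ cycles $Z_1,\ldots,Z_n$ together with vertices $a_j,b_j\in Z_j$ ($j=1,\ldots,n$) such that $Z_i\cap Z_j=\emptyset$ whenever $|i-j|>1$, and $Z_{j-1}\cap Z_j=\{b_{j-1}\}=\{a_j\}$ for every $j=2,\ldots,n$. A chain of cycles is a chain of $n$ cycles for some $n\ge 1$. -}

module Defs where

open import Data.Fin.Base using (Fin; toℕ)
open import Data.List.Base using (List; length; filter; tabulate; cartesianProduct)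
open import Data.Nat.Base using (ℕ; suc; _≤_; _<_; _>_; _≥_; ∣_-_∣)
open import Data.Nat.Properties using (_≤?_; _<?_)
open import Data.Product.Base using (Σ-syntax; ∃-syntax; _×_; _,_)
open import Data.Sum.Base using (_⊎_)
open import Function.Bundles using (_↔_; _⇔_; Inverse)
open import Function.Definitions using (Injective)
open import Level using (0ℓ)
open import Relation.Binary.Core using (Rel)
open import Relation.Binary.Definitions using (Decidable; Symmetric)
open import Relation.Binary.PropositionalEquality.Core using (_≡_)
open import Relation.Nullary.Decidable.Core using (Dec; _×-dec_)
open import Relation.Nullary.Negation.Core using (¬_)
open import Relation.Unary using (Pred)

record Graph : Set₁ where
  field
    V      : Set
    order  : ℕ
    enum   : V ↔ Fin order
    Adj    : Rel V 0ℓ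
    adj?   : Decidable Adj
    symm   : Symmetric Adj
    irrefl : ∀ v → ¬ Adj v v

  vertices : List V
  vertices = tabulate (Inverse.from enum)

module _ (G : Graph) where
  open Graph G

  Numbering : Set
  Numbering = V ↔ Fin order

  -- Numbers run over 1, …, order.
  number : Numbering → V → ℕ
  number π v = suc (toℕ (Inverse.to π v))

  -- An edge crossing the cut is counted once, oriented from its
  -- lower-numbered endpoint to its higher-numbered one.
  Crosses : Numbering → ℕ → V × V → Set
  Crosses π i (u , v) = Adj u v × number π u ≤ i × i < number π v

  crosses? : ∀ π i (e : V × V) → Dec (Crosses π i e)
  crosses? π i (u , v) =
    adj? u v ×-dec (number π u ≤? i) ×-dec (i <? number π v)

  cutSize : Numbering → ℕ → ℕ
  cutSize π i =
    length (filter (crosses? π i) (cartesianProduct vertices vertices))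

  CutwidthAtMost : ℕ → Set
  CutwidthAtMost k =
    Σ[ π ∈ Numbering ] (∀ i → 1 ≤ i → i < order → cutSize π i ≤ k)

-- Successor modulo m.
CyclicSuc : ∀ {m} → Fin m → Fin m → Set
CyclicSuc {m} i j =
  (toℕ j ≡ suc (toℕ i)) ⊎ (suc (toℕ i) ≡ m × toℕ j ≡ 0)

-- A cycle with vertices in V: its edges join cyclically consecutive entries
-- of an injective sequence.
record Cycle (V : Set) : Set where
  field
    len       : ℕ
    len≥3     : len ≥ 3
    vertex    : Fin len → V
    injective : Injective _≡_ _≡_ vertex

module _ {V : Set} where

  infix 4 _∈ᶜ_

  _∈ᶜ_ : V → Cycle V → Set
  v ∈ᶜ Z = ∃[ i ] Cycle.vertex Z i ≡ v

  CycleEdge : Cycle V → V → V → Set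
  CycleEdge Z u v = ∃[ i ] ∃[ j ] CyclicSuc i j ×
    ((vertex i ≡ u × vertex j ≡ v) ⊎ (vertex i ≡ v × vertex j ≡ u))
    where open Cycle Z

-- Intersections of cycles are stated for vertex sets: cycles sharing at most
-- one vertex share no edge.
record ChainOfCycles (n : ℕ) (H : Graph) : Set where
  open Graph H
  field
    Z           : Fin n → Cycle V
    a b         : Fin n → V
    a∈Z         : ∀ j → a j ∈ᶜ Z j
    b∈Z         : ∀ j → b j ∈ᶜ Z j
    vertexUnion : ∀ v → ∃[ j ] v ∈ᶜ Z j
    edgeUnion   : ∀ u v → Adj u v ⇔ (∃[ j ] CycleEdge (Z j) u v)
    disjoint    : ∀ i j → ∣ toℕ i - toℕ j ∣ > 1 →
                  ∀ v → ¬ (v ∈ᶜ Z i × v ∈ᶜ Z j)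
    meetAtB     : ∀ i j → toℕ j ≡ suc (toℕ i) →
                  ∀ v → (v ∈ᶜ Z i × v ∈ᶜ Z j) ⇔ v ≡ b i
    meetAtA     : ∀ i j → toℕ j ≡ suc (toℕ i) →
                  ∀ v → (v ∈ᶜ Z i × v ∈ᶜ Z j) ⇔ v ≡ a j

IsChainOfCycles : Graph → Set
IsChainOfCycles H = ∃[ n ] n ≥ 1 × ChainOfCycles n H

record Subgraph (H : Graph) : Set₁ where
  open Graph H
  field
    InV     : Pred V 0ℓ
    InE     : Rel V 0ℓ
    E-sym   : Symmetric InE
    E⊆Adj   : ∀ {u v} → InE u v → Adj u v
    E-endsˡ : ∀ {u v} → InE u v → InV u

record _≅_ (G : Graph) {H : Graph} (S : Subgraph H) : Set where
  private
    module G = Graph G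
    module H = Graph H
  open Subgraph S
  field
    f         : G.V → H.V
    injective : Injective _≡_ _≡_ f
    image     : ∀ w → InV w ⇔ (∃[ v ] f v ≡ w)
    edges     : ∀ u v → G.Adj u v ⇔ InE (f u) (f v)

IsomorphicToSubgraphOf : Graph → Graph → Set₁
IsomorphicToSubgraphOf G H = Σ[ S ∈ Subgraph H ] G ≅ S

{-# OPTIONS --safe #-}

-- From a chain of cycles to a layout: read every cycle from one joint to the other and place its two
-- arcs one after the other, the joints first and last.  The edges of the first arcs form one family of
-- non-overlapping intervals, those of the second arcs another, so a cut meets at most two edges.
--
-- From a layout to a chain of cycles: sweep the vertices in order, growing a path whose two ends carry
-- the at most two edges leaving the vertices swept so far, one edge per end.  If both edges pass the
-- next vertex v, then v is isolated; if one does, v prolongs the path at the other end; if none does,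
-- v closes the path to a cycle and starts the next one.  Spare vertices keep the cycles long enough.
module Submission where

open import Defs
open import Data.Bool.Base using (Bool; true; false)
open import Data.Empty using (⊥; ⊥-elim)
open import Data.Fin.Base using (Fin; zero; suc; toℕ; fromℕ<; punchOut)
import Data.Fin.Properties as Fin
open import Data.List.Base using (List; []; _∷_; _++_; _∷ʳ_; reverse; length; map; filter; lookup; allFin; cartesianProduct)
open import Data.List.Membership.Propositional using (_∈_; lose)
open import Data.List.Membership.Propositional.Properties
  using (∈-lookup; ∈-map⁺; ∈-map⁻; ∈-filter⁺; ∈-filter⁻; ∈-tabulate⁺; ∈-allFin; ∈-++⁺ˡ; ∈-++⁺ʳ; ∈-cartesianProduct⁺)
open import Data.List.Properties using (length-tabulate; length-++; length-map; unfold-reverse; reverse-++)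
open import Data.List.Relation.Binary.Permutation.Setoid using (↭-sym)
import Data.List.Relation.Binary.Permutation.Setoid.Properties as Permutation
open import Data.List.Relation.Binary.Subset.Propositional using (_⊆_)
open import Data.List.Relation.Unary.All as All using (All; []; _∷_)
import Data.List.Relation.Unary.All.Properties as All
open import Data.List.Relation.Unary.AllPairs using ([]; _∷_)
open import Data.List.Relation.Unary.Any as Any using (Any; here; there; index)
open import Data.List.Relation.Unary.Any.Properties using (lookup-index; reverse⁺; reverse⁻)
open import Data.List.Relation.Unary.Unique.Propositional using (Unique)
import Data.List.Relation.Unary.Unique.Propositional.Properties as Unique
open import Data.Maybe.Base using (Maybe; just; nothing)
open import Data.Maybe.Properties using (just-injective)
open import Data.Nat.Base using (ℕ; zero; suc; _+_; _*_; _∸_; _≤_; _<_; _>_; z≤n; s≤s; ∣_-_∣)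
import Data.Nat.Properties as ℕ
open import Data.Nat.Properties hiding (_≟_)
open import Data.Product.Base using (∃-syntax; _×_; _,_; proj₁; proj₂)
open import Data.Product.Properties using (,-injectiveʳ)
open import Data.Sum.Base using (_⊎_; inj₁; inj₂; swap) renaming (map to map⊎)
open import Data.Sum.Properties using (inj₁-injective; inj₂-injective) renaming (≡-dec to ⊎-≡-dec)
open import Function.Base using (id; _∘_)
open import Function.Bundles using (_↔_; _⇔_; mk⇔; mk↔ₛ′; Inverse; Equivalence; Injection)
open import Function.Definitions using (Injective)
open import Function.Properties.Inverse using (Inverse⇒Injection; ↔-sym)
open import Relation.Binary.Definitions using (Decidable; DecidableEquality; tri<; tri≈; tri>)
open import Relation.Binary.PropositionalEquality
open import Relation.Nullary using (¬_; Dec; yes; no; contradiction; _×-dec_; _⊎-dec_)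

-- Both directions exploit that a subgraph may leave edges out. The layout is made for the subgraph
-- itself, from ranks pulled back from the chain. The sweep may link vertices that are not adjacent,
-- so a path end without an outgoing edge can be treated like one whose edge ends at the next vertex
-- `v`. The invariant survives a step because of the cut just after `v`: each carried edge that
-- passes `v` takes one of its two places, and the edges starting at `v` share the rest. A path just
-- restarted is a single vertex that serves as both ends and may carry two edges. The obstacle is
-- that every vertex of a chain lies on a cycle: vertices skipped by the sweep and unspent spare
-- labels must go somewhere. So the set of labels is fixed beforehand, and one last cycle takes all
-- that are left over.

to-injective : ∀ {A B : Set} (e : A ↔ B) → Injective _≡_ _≡_ (Inverse.to e)
to-injective e = Injection.injective (Inverse⇒Injection e)

from-injective : ∀ {A B : Set} (e : A ↔ B) → Injective _≡_ _≡_ (Inverse.from e)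
from-injective e = to-injective (↔-sym e)

-- Counting in duplicate-free lists and finite sets

lookup-injective : ∀ {A : Set} {xs : List A} → Unique xs → Injective _≡_ _≡_ (lookup xs)
lookup-injective (x∉ ∷ u) {zero}  {zero}  _  = refl
lookup-injective (x∉ ∷ u) {zero}  {suc j} eq = contradiction eq (All.lookup x∉ (∈-lookup j))
lookup-injective (x∉ ∷ u) {suc i} {zero}  eq = contradiction (sym eq) (All.lookup x∉ (∈-lookup i))
lookup-injective (x∉ ∷ u) {suc i} {suc j} eq = cong suc (lookup-injective u eq)

length-mono-⊆ : ∀ {A : Set} {xs ys : List A} → Unique xs → xs ⊆ ys → length xs ≤ length ys
length-mono-⊆ {xs = xs} {ys} u sub = Fin.injective⇒≤ {f = f} f-injective
  where
  f : Fin (length xs) → Fin (length ys)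
  f i = index (sub (∈-lookup i))
  lookup-f : ∀ i → lookup xs i ≡ lookup ys (f i)
  lookup-f i = lookup-index (sub (∈-lookup i))
  f-injective : Injective _≡_ _≡_ f
  f-injective {i} {j} eq = lookup-injective u
    (trans (lookup-f i) (trans (cong (lookup ys) eq) (sym (lookup-f j))))

-- Pigeonhole: two of any three entries share a colour `c`, and `P c` holds of at most one element.
length≤2 : ∀ {A : Set} (P : Bool → A → Set) →
           (∀ {c x y} → P c x → P c y → x ≡ y) →
           ∀ {xs} → Unique xs → All (λ x → ∃[ c ] P c x) xs → length xs ≤ 2
length≤2 P P! [] [] = z≤n
length≤2 P P! (_ ∷ []) (_ ∷ []) = s≤s z≤n
length≤2 P P! (_ ∷ _ ∷ []) (_ ∷ _ ∷ []) = s≤s (s≤s z≤n)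
length≤2 P P! ((x≢y ∷ x≢z ∷ _) ∷ (y≢z ∷ _) ∷ _) ((c , p) ∷ (d , q) ∷ (e , r) ∷ _) =
  ⊥-elim (clash c d e p q r)
  where
  clash : ∀ c d e → P c _ → P d _ → P e _ → ⊥
  clash true  true  _     p q _ = x≢y (P! p q)
  clash false false _     p q _ = x≢y (P! p q)
  clash true  false true  p _ r = x≢z (P! p r)
  clash false true  false p _ r = x≢z (P! p r)
  clash true  false false _ q r = y≢z (P! q r)
  clash false true  true  _ q r = y≢z (P! q r)

-- A missed value could be punched out, leaving an injection of `Fin (suc n)` into `Fin n`.
injective⇒surjective : ∀ {n} {f : Fin n → Fin n} → Injective _≡_ _≡_ f → ∀ y → ∃[ x ] f x ≡ y
injective⇒surjective {suc n} {f} f-inj y with Fin.any? (λ x → f x Fin.≟ y)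
... | yes hit  = hit
... | no  miss = contradiction (Fin.injective⇒≤ {f = λ x → punchOut (y≢f x)}
        (λ eq → f-inj (Fin.punchOut-injective (y≢f _) (y≢f _) eq))) 1+n≰n
  where
  y≢f : ∀ x → y ≢ f x
  y≢f x y≡fx = miss (x , sym y≡fx)

-- Numberings obtained from rank functions

module _ (G : Graph) where
  open Graph G

  vertices! : Unique vertices
  vertices! = Unique.tabulate⁺ (from-injective enum)

  ∈-vertices : ∀ v → v ∈ vertices
  ∈-vertices v = subst (_∈ vertices) (Inverse.strictlyInverseʳ enum v) (∈-tabulate⁺ (Inverse.to enum v))

-- Rank intervals of edges of the same colour do not overlap, so a cut meets at most one edge of each
-- of the two colours.
module Layout (G : Graph)
  (rank : Graph.V G → ℕ) (rank-injective : Injective _≡_ _≡_ rank)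
  (Colour : Bool → Graph.V G → Graph.V G → Set)
  (coloured : ∀ {u v} → Graph.Adj G u v → rank u < rank v → ∃[ c ] Colour c u v)
  (separated : ∀ {c u v u′ v′} → Colour c u v → Colour c u′ v′ →
               rank u < rank v′ → rank u′ < rank v → u ≡ u′ × v ≡ v′)
  where
  open Graph G

  -- Ranks may have gaps; counting the vertices of smaller rank closes them and keeps the order.
  below : V → List V
  below v = filter (λ w → rank w <? rank v) vertices

  below! : ∀ v → Unique (v ∷ below v)
  below! v = All.¬Any⇒All¬ _ (λ v∈ → <-irrefl refl (proj₂ (∈-filter⁻ _ {xs = vertices} v∈)))
             ∷ Unique.filter⁺ _ (vertices! G)

  below-< : ∀ v → length (below v) < order
  below-< v = subst (length (below v) <_) (length-tabulate (Inverse.from enum))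
    (length-mono-⊆ (below! v) λ {w} _ → ∈-vertices G w)

  below-mono : ∀ {u v} → rank u < rank v → length (below u) < length (below v)
  below-mono {u} {v} u<v = length-mono-⊆ (below! u) λ where
    (here refl) → ∈-filter⁺ _ (∈-vertices G _) u<v
    (there w∈)  → let w∈V , w<u = ∈-filter⁻ _ {xs = vertices} w∈ in ∈-filter⁺ _ w∈V (<-trans w<u u<v)

  place : V → Fin order
  place v = fromℕ< (below-< v)

  toℕ-place : ∀ v → toℕ (place v) ≡ length (below v)
  toℕ-place v = Fin.toℕ-fromℕ< (below-< v)

  place-injective : Injective _≡_ _≡_ place
  place-injective {u} {v} eq with <-cmp (rank u) (rank v)
  ... | tri≈ _ r≡ _ = rank-injective r≡
  ... | tri< r< _ _ = contradiction (below-mono r<) (<-irrefl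
          (trans (sym (toℕ-place u)) (trans (cong toℕ eq) (toℕ-place v))))
  ... | tri> _ _ r> = contradiction (below-mono r>) (<-irrefl
          (trans (sym (toℕ-place v)) (trans (cong toℕ (sym eq)) (toℕ-place u))))

  place-surjective : ∀ y → ∃[ v ] place v ≡ y
  place-surjective y =
    let x , eq = injective⇒surjective {f = place ∘ Inverse.from enum}
                   (from-injective enum ∘ place-injective) y
    in Inverse.from enum x , eq

  numbering : Numbering G
  numbering = mk↔ₛ′ place (proj₁ ∘ place-surjective) (proj₂ ∘ place-surjective)
    (λ v → place-injective (proj₂ (place-surjective (place v))))

  number-reflects-< : ∀ {u v} → number G numbering u < number G numbering v → rank u < rank v
  number-reflects-< {u} {v} (s≤s u<v) with <-cmp (rank u) (rank v)
  ... | tri< r< _ _ = r<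
  ... | tri≈ _ r≡ _ = contradiction u<v (<-irrefl (cong (toℕ ∘ place) (rank-injective r≡)))
  ... | tri> _ _ r> = contradiction (below-mono r>) (<-asym (subst₂ _<_ (toℕ-place u) (toℕ-place v) u<v))

  cutwidth≤2 : CutwidthAtMost G 2
  cutwidth≤2 = numbering , λ i _ _ → length≤2 (CrossesIn i) CrossesIn!
    (Unique.filter⁺ (crosses? G numbering i) (Unique.cartesianProduct⁺ (vertices! G) (vertices! G)))
    (All.map (λ where cr@(adj , u≤ , <v) →
                       let c , col = coloured adj (number-reflects-< (≤-<-trans u≤ <v)) in c , cr , col)
             (All.all-filter (crosses? G numbering i) (cartesianProduct vertices vertices)))
    where
    CrossesIn : ℕ → Bool → V × V → Set
    CrossesIn i c (u , v) = Crosses G numbering i (u , v) × Colour c u v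
    CrossesIn! : ∀ {i c e e′} → CrossesIn i c e → CrossesIn i c e′ → e ≡ e′
    CrossesIn! ((_ , u≤ , <v) , col) ((_ , u′≤ , <v′) , col′) with separated col col′
      (number-reflects-< (≤-<-trans u≤ <v′)) (number-reflects-< (≤-<-trans u′≤ <v))
    ... | refl , refl = refl

-- Layout of a chain of cycles

module Rotation {m : ℕ} (α : Fin m) where

  -- The residue of `i - α` modulo `m`: the position of `i` when the cycle is read from `α`.
  pos : Fin m → ℕ
  pos i with toℕ α ≤? toℕ i
  ... | yes _ = toℕ i ∸ toℕ α
  ... | no  _ = toℕ i + m ∸ toℕ α

  pos-spec : ∀ i → (toℕ α + pos i ≡ toℕ i) ⊎ (toℕ α + pos i ≡ toℕ i + m × toℕ i < toℕ α)
  pos-spec i with toℕ α ≤? toℕ i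
  ... | yes α≤i = inj₁ (m+[n∸m]≡n α≤i)
  ... | no  α≰i = inj₂ (m+[n∸m]≡n (≤-trans (<⇒≤ (Fin.toℕ<n α)) (m≤n+m m (toℕ i))) , ≰⇒> α≰i)

  pos< : ∀ i → pos i < m
  pos< i with pos-spec i
  ... | inj₁ eq = ≤-<-trans (subst (pos i ≤_) eq (m≤n+m (pos i) (toℕ α))) (Fin.toℕ<n i)
  ... | inj₂ (eq , i<α) = +-cancelˡ-< (toℕ α) _ _ (subst (_< toℕ α + m) (sym eq) (+-monoˡ-< m i<α))

  pos-injective : Injective _≡_ _≡_ pos
  pos-injective {i} {j} eq with pos-spec i | pos-spec j
  ... | inj₁ p | inj₁ q = Fin.toℕ-injective (trans (sym p) (trans (cong (toℕ α +_) eq) q))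
  ... | inj₂ (p , _) | inj₂ (q , _) =
        Fin.toℕ-injective (+-cancelʳ-≡ m _ _ (trans (sym p) (trans (cong (toℕ α +_) eq) q)))
  ... | inj₁ p | inj₂ (q , _) = contradiction
        (subst (_< m) (trans (sym p) (trans (cong (toℕ α +_) eq) q)) (Fin.toℕ<n i)) (m+n≮n (toℕ j) m)
  ... | inj₂ (p , _) | inj₁ q = contradiction
        (subst (_< m) (trans (sym q) (trans (cong (toℕ α +_) (sym eq)) p)) (Fin.toℕ<n j)) (m+n≮n (toℕ i) m)

  pos-α : pos α ≡ 0
  pos-α with pos-spec α
  ... | inj₁ eq = +-cancelˡ-≡ (toℕ α) _ _ (trans eq (sym (+-identityʳ _)))
  ... | inj₂ (_ , α<α) = contradiction α<α (<-irrefl refl)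

  pos-suc : ∀ {i j} → CyclicSuc i j → (pos j ≡ suc (pos i)) ⊎ (suc (pos i) ≡ m × pos j ≡ 0)
  pos-suc {i} {j} (inj₁ j≡1+i) with pos-spec i | pos-spec j
  ... | inj₁ p | inj₁ q = inj₁ (+-cancelˡ-≡ (toℕ α) _ _
        (trans q (trans j≡1+i (trans (cong suc (sym p)) (sym (+-suc _ _))))))
  ... | inj₁ p | inj₂ (_ , j<α) = contradiction
        (≤-trans (subst (toℕ α ≤_) p (m≤m+n _ _)) (subst (toℕ i ≤_) (sym j≡1+i) (n≤1+n _))) (<⇒≱ j<α)
  ... | inj₂ (p , i<α) | inj₁ q = inj₂
        ( +-cancelˡ-≡ (toℕ α) _ _
            (trans (+-suc _ _) (trans (cong suc p) (cong (_+ m) (sym α≡1+i))))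
        , +-cancelˡ-≡ (toℕ α) _ _ (trans q (trans j≡1+i (trans (sym α≡1+i) (sym (+-identityʳ _))))))
    where
    α≡1+i : toℕ α ≡ suc (toℕ i)
    α≡1+i = ≤-antisym (subst (toℕ α ≤_) (trans q j≡1+i) (m≤m+n _ _)) i<α
  ... | inj₂ (p , _) | inj₂ (q , _) = inj₁ (+-cancelˡ-≡ (toℕ α) _ _
        (trans q (trans (cong (_+ m) j≡1+i) (trans (cong suc (sym p)) (sym (+-suc _ _))))))
  pos-suc {i} {j} (inj₂ (1+i≡m , j≡0)) with pos-spec i | pos-spec j
  ... | inj₂ (_ , i<α) | _ = contradiction (subst (_≤ toℕ α) 1+i≡m i<α) (<⇒≱ (Fin.toℕ<n α))
  ... | inj₁ p | inj₁ q = inj₂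
        ( trans (cong suc (trans (cong (_+ pos i) (sym α≡0)) p)) 1+i≡m
        , m+n≡0⇒n≡0 (toℕ α) (trans q j≡0))
    where
    α≡0 : toℕ α ≡ 0
    α≡0 = m+n≡0⇒m≡0 (toℕ α) (trans q j≡0)
  ... | inj₁ p | inj₂ (q , _) = inj₁ (+-cancelˡ-≡ (toℕ α) _ _
        (trans q (trans (cong (_+ m) j≡0) (trans (sym 1+i≡m) (trans (cong suc (sym p)) (sym (+-suc _ _)))))))

-- A cycle of length m ≤ M / 2 is read from its first joint at position 0, with its second joint at
-- position s.  The interior of the arc 0, …, s gets levels below m, increasingly; the interior of the
-- arc s, …, m ≡ 0 gets levels above M ∸ m, decreasingly.
module Level (M s : ℕ) where

  level : ℕ → ℕ
  level t with <-cmp t s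
  ... | tri< _ _ _ = t
  ... | tri≈ _ _ _ = M
  ... | tri> _ _ _ = M ∸ t

  level-< : ∀ {t} → t < s → level t ≡ t
  level-< {t} t<s with <-cmp t s
  ... | tri< _ _ _   = refl
  ... | tri≈ t≮s _ _ = contradiction t<s t≮s
  ... | tri> t≮s _ _ = contradiction t<s t≮s

  level-≡ : level s ≡ M
  level-≡ with <-cmp s s
  ... | tri< _ s≢s _ = contradiction refl s≢s
  ... | tri≈ _ _ _   = refl
  ... | tri> _ s≢s _ = contradiction refl s≢s

  level-> : ∀ {t} → s < t → level t ≡ M ∸ t
  level-> {t} s<t with <-cmp t s
  ... | tri< _ _ s≮t = contradiction s<t s≮t
  ... | tri≈ _ _ s≮t = contradiction s<t s≮t
  ... | tri> _ _ _   = refl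

  module _ {m : ℕ} (0<s : 0 < s) (s<m : s < m) (m+m≤M : m + m ≤ M) where

    m<M : m < M
    m<M = <-≤-trans (m<m+n m (<-trans 0<s s<m)) m+m≤M

    -- This keeps the levels on the second arc above those in the interior of the first, which are
    -- below `m`.
    m≤M∸ : ∀ {t} → t < m → m ≤ M ∸ t
    m≤M∸ {t} t<m = ≤-trans (m+n≤o⇒m≤o∸n m m+m≤M) (∸-monoʳ-≤ M (<⇒≤ t<m))

    level≤M : ∀ {t} → t < m → level t ≤ M
    level≤M {t} t<m with <-cmp t s
    ... | tri< _ _ _ = <⇒≤ (<-trans t<m m<M)
    ... | tri≈ _ _ _ = ≤-refl
    ... | tri> _ _ _ = m∸n≤m M t

    M∸t<M : ∀ {t} → s < t → t < m → M ∸ t < M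
    M∸t<M s<t t<m = ∸-monoʳ-< (≤-<-trans z≤n s<t) (<⇒≤ (<-trans t<m m<M))

    level≡0⇒≡0 : ∀ {t} → t < m → level t ≡ 0 → t ≡ 0
    level≡0⇒≡0 {t} t<m eq with <-cmp t s
    ... | tri< _ _ _ = eq
    ... | tri≈ _ _ _ = contradiction (subst (m <_) eq m<M) λ ()
    ... | tri> _ _ _ = contradiction (<-≤-trans t<m (subst (m ≤_) eq (m≤M∸ t<m))) λ ()

    level≡M⇒≡s : ∀ {t} → t < m → level t ≡ M → t ≡ s
    level≡M⇒≡s {t} t<m eq with <-cmp t s
    ... | tri< _ _ _   = contradiction (<-trans t<m m<M) (<-irrefl eq)
    ... | tri≈ _ t≡s _ = t≡s
    ... | tri> _ _ s<t = contradiction (M∸t<M s<t t<m) (<-irrefl eq)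

    level-injective : ∀ {t u} → t < m → u < m → level t ≡ level u → t ≡ u
    level-injective {t} {u} t<m u<m eq with <-cmp t s | <-cmp u s
    ... | tri< _ _ _   | tri< _ _ _   = eq
    ... | tri< _ _ _   | tri≈ _ _ _   = contradiction (<-trans t<m m<M) (<-irrefl eq)
    ... | tri< _ _ _   | tri> _ _ _   = contradiction (<-≤-trans t<m (m≤M∸ u<m)) (<-irrefl eq)
    ... | tri≈ _ _ _   | tri< _ _ _   = contradiction (<-trans u<m m<M) (<-irrefl (sym eq))
    ... | tri≈ _ t≡s _ | tri≈ _ u≡s _ = trans t≡s (sym u≡s)
    ... | tri≈ _ _ _   | tri> _ _ s<u = contradiction (M∸t<M s<u u<m) (<-irrefl (sym eq))
    ... | tri> _ _ _   | tri< _ _ _   = contradiction (<-≤-trans u<m (m≤M∸ t<m)) (<-irrefl (sym eq))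
    ... | tri> _ _ s<t | tri≈ _ _ _   = contradiction (M∸t<M s<t t<m) (<-irrefl eq)
    ... | tri> _ _ _   | tri> _ _ _   =
          ∸-cancelˡ-≡ (<⇒≤ (<-trans t<m m<M)) (<⇒≤ (<-trans u<m m<M)) eq

    level-increasing : ∀ {t} → t < s → level t < level (suc t)
    level-increasing {t} t<s with m≤n⇒m<n∨m≡n t<s
    ... | inj₁ 1+t<s = subst₂ _<_ (sym (level-< t<s)) (sym (level-< 1+t<s)) (n<1+n t)
    ... | inj₂ refl  = subst₂ _<_ (sym (level-< t<s)) (sym level-≡) (<-trans t<s (<-trans s<m m<M))

    level-antitone : ∀ {t u} → s ≤ t → t ≤ u → u < m → level u ≤ level t
    level-antitone s≤t t≤u u<m with m≤n⇒m<n∨m≡n s≤t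
    ... | inj₂ refl = ≤-trans (level≤M u<m) (≤-reflexive (sym level-≡))
    ... | inj₁ s<t  = subst₂ _≤_ (sym (level-> (<-≤-trans s<t t≤u))) (sym (level-> s<t)) (∸-monoʳ-≤ M t≤u)

    level-decreasing : ∀ {t} → s ≤ t → suc t < m → level (suc t) < level t
    level-decreasing s≤t 1+t<m = ≤∧≢⇒< (level-antitone s≤t (n≤1+n _) 1+t<m)
      λ eq → 1+n≢n (level-injective 1+t<m (<-trans (n<1+n _) 1+t<m) eq)

block-≤ : ∀ {M x x′} j j′ → x′ ≤ M → j * M + x < j′ * M + x′ → j ≤ j′
block-≤ {M} {x} {x′} j j′ x′≤M lt = ≮⇒≥ λ j′<j → <⇒≱ lt (begin
  j′ * M + x′ ≤⟨ +-monoʳ-≤ (j′ * M) x′≤M ⟩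
  j′ * M + M  ≡⟨ +-comm (j′ * M) M ⟩
  suc j′ * M  ≤⟨ *-monoˡ-≤ M j′<j ⟩
  j * M       ≤⟨ m≤m+n (j * M) x ⟩
  j * M + x   ∎)
  where open ≤-Reasoning

-- Blocks overlap only in a boundary value: `j * M + x ≤ suc j * M ≤ j′ * M ≤ j′ * M + x′`, and
-- equality of the outer terms forces equality throughout.
block-≡ : ∀ {M x x′} j j′ → 0 < M → x ≤ M → j * M + x ≡ j′ * M + x′ → j < j′ →
          j′ ≡ suc j × x ≡ M × x′ ≡ 0
block-≡ {M@(suc _)} {x} {x′} j j′ _ x≤M eq j<j′ = j′≡ , x≡M , x′≡0
  where
  open ≤-Reasoning
  upper : j′ * M + x′ ≤ suc j * M
  upper = begin
    j′ * M + x′ ≡⟨ sym eq ⟩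
    j * M + x   ≤⟨ +-monoʳ-≤ (j * M) x≤M ⟩
    j * M + M   ≡⟨ +-comm (j * M) M ⟩
    suc j * M   ∎
  j′≡ : j′ ≡ suc j
  j′≡ = ≤-antisym (*-cancelʳ-≤ j′ (suc j) M (≤-trans (m≤m+n _ x′) upper)) j<j′
  x′≡0 : x′ ≡ 0
  x′≡0 = n≤0⇒n≡0 (+-cancelˡ-≤ (j′ * M) x′ 0 (begin
    j′ * M + x′ ≤⟨ upper ⟩
    suc j * M   ≤⟨ *-monoˡ-≤ M j<j′ ⟩
    j′ * M      ≡⟨ sym (+-identityʳ _) ⟩
    j′ * M + 0  ∎))
  x≡M : x ≡ M
  x≡M = +-cancelˡ-≡ (j * M) x M (begin-equality
    j * M + x      ≡⟨ eq ⟩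
    j′ * M + x′    ≡⟨ cong (j′ * M +_) x′≡0 ⟩
    j′ * M + 0     ≡⟨ +-identityʳ _ ⟩
    j′ * M         ≡⟨ cong (_* M) j′≡ ⟩
    suc j * M      ≡⟨ +-comm M (j * M) ⟩
    j * M + M      ∎)

otherIndex : ∀ {m} → 3 ≤ m → (i : Fin m) → ∃[ k ] k ≢ i
otherIndex (s≤s (s≤s _)) zero    = suc zero , λ ()
otherIndex (s≤s _)       (suc i) = zero , λ ()

module ChainLayout {n : ℕ} (H : Graph) (C : ChainOfCycles n H) where
  open Graph H
  open ChainOfCycles C

  module _ (j : Fin n) where
    open Cycle (Z j) public using () renaming (len to len; vertex to vtx; injective to vtx-inj)

  record Joints (j : Fin n) : Set where
    field
      α β   : Fin (len j)
      β≢α   : β ≢ α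
      is-a  : ∀ {k : Fin n} → toℕ j ≡ suc (toℕ k) → vtx j α ≡ a j
      is-b  : ∀ {k : Fin n} → toℕ k ≡ suc (toℕ j) → vtx j β ≡ b j

  -- The joints of the chain, except that the free end of the first and of the last cycle, where
  -- a j ≡ b j is possible, is moved off the other joint.
  joints : ∀ j → Joints j
  joints j with suc (toℕ j) <? n | toℕ j in j≡
  ... | no  j≮ | _ = record
    { α = proj₁ (a∈Z j) ; β = proj₁ other ; β≢α = proj₂ other
    ; is-a = λ _ → proj₂ (a∈Z j)
    ; is-b = λ {k} eq → contradiction (subst (_< n) eq (Fin.toℕ<n k)) j≮ }
    where other = otherIndex (Cycle.len≥3 (Z j)) (proj₁ (a∈Z j))
  ... | yes j< | zero = record
    { α = proj₁ other ; β = proj₁ (b∈Z j) ; β≢α = λ eq → proj₂ other (sym eq)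
    ; is-a = λ eq → contradiction (trans (sym j≡) eq) λ ()
    ; is-b = λ _ → proj₂ (b∈Z j) }
    where other = otherIndex (Cycle.len≥3 (Z j)) (proj₁ (b∈Z j))
  ... | yes j< | suc i = record
    { α = proj₁ (a∈Z j) ; β = proj₁ (b∈Z j) ; β≢α = distinct
    ; is-a = λ _ → proj₂ (a∈Z j)
    ; is-b = λ _ → proj₂ (b∈Z j) }
    where
    i<n = <-trans (n<1+n i) (subst (_< n) j≡ (Fin.toℕ<n j))
    prev next : Fin n
    prev = fromℕ< i<n
    next = fromℕ< j<
    prev≡ : toℕ prev ≡ i
    prev≡ = Fin.toℕ-fromℕ< i<n
    next≡ : toℕ next ≡ suc (toℕ j)
    next≡ = Fin.toℕ-fromℕ< j<
    distinct : proj₁ (b∈Z j) ≢ proj₁ (a∈Z j)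
    -- A common joint would lie on both neighbouring cycles, whose indices differ by two.
    distinct eq = disjoint prev next far (b j)
      ( subst (_∈ᶜ Z prev) (trans (sym (proj₂ (a∈Z j))) (trans (cong (vtx j) (sym eq)) (proj₂ (b∈Z j))))
          (proj₁ (Equivalence.from (meetAtA prev j (trans j≡ (cong suc (sym prev≡))) (a j)) refl))
      , proj₂ (Equivalence.from (meetAtB j next next≡ (b j)) refl))
      where
      far : 1 < ∣ toℕ prev - toℕ next ∣
      far = subst₂ (λ x y → 1 < ∣ x - y ∣) (sym prev≡) (sym (trans next≡ (cong suc j≡))) (dist i)
        where
        dist : ∀ i → 1 < ∣ i - suc (suc i) ∣
        dist zero    = s≤s (s≤s z≤n)
        dist (suc i) = dist i

  -- No cycle is longer than `order`, so one block size meets the requirement `m + m ≤ M` for all of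
  -- them.
  M : ℕ
  M = order + order

  module _ (j : Fin n) where
    open Joints (joints j)
    open Rotation α public using () renaming (pos to pos)

    split : ℕ
    split = pos β

    0<split : 0 < split
    0<split = n≢0⇒n>0 λ eq → β≢α (Rotation.pos-injective α (trans eq (sym (Rotation.pos-α α))))

    split< : split < len j
    split< = Rotation.pos< α β

    len≤order : len j ≤ order
    len≤order = Fin.injective⇒≤ {f = Inverse.to enum ∘ vtx j} (vtx-inj j ∘ to-injective enum)

    2len≤M : len j + len j ≤ M
    2len≤M = +-mono-≤ len≤order len≤order

    height : Fin (len j) → ℕ
    height i = Level.level M split (pos i)

  -- The top level `M` of a block coincides with the bottom of the next block, so a joint gets the
  -- same rank from both of its cycles.
  rankAt : ∀ j → Fin (len j) → ℕ
  rankAt j i = toℕ j * M + height j i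

  module _ {j : Fin n} where
    open Joints (joints j)
    open Level M (split j)

    rankAt-α : rankAt j α ≡ toℕ j * M
    rankAt-α = trans (cong (toℕ j * M +_) (trans (cong level (Rotation.pos-α α)) (level-< (0<split j))))
      (+-identityʳ _)

    rankAt-β : rankAt j β ≡ suc (toℕ j) * M
    rankAt-β = trans (cong (toℕ j * M +_) level-≡) (+-comm _ M)

    height≤M : ∀ i → height j i ≤ M
    height≤M i = level≤M (0<split j) (split< j) (2len≤M j) (Rotation.pos< α i)

    height-injective : Injective _≡_ _≡_ (height j)
    height-injective {i} {k} eq = Rotation.pos-injective α
      (level-injective (0<split j) (split< j) (2len≤M j) (Rotation.pos< α i) (Rotation.pos< α k) eq)

    height≡0⇒α : ∀ {i} → height j i ≡ 0 → i ≡ α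
    height≡0⇒α {i} eq = Rotation.pos-injective α (trans
      (level≡0⇒≡0 (0<split j) (split< j) (2len≤M j) (Rotation.pos< α i) eq) (sym (Rotation.pos-α α)))

    height≡M⇒β : ∀ {i} → height j i ≡ M → i ≡ β
    height≡M⇒β {i} eq = Rotation.pos-injective α
      (level≡M⇒≡s (0<split j) (split< j) (2len≤M j) (Rotation.pos< α i) eq)

    0<M : 0 < M
    0<M = <-trans (≤-<-trans z≤n (split< j)) (m<M (0<split j) (split< j) (2len≤M j))

    height-upper : ∀ {i k} → CyclicSuc i k → pos j i < split j →
                   pos j k ≡ suc (pos j i) × height j i < height j k
    height-upper i↝k i<s with Rotation.pos-suc α i↝k
    ... | inj₁ eq = eq , subst (λ t → height j _ < level t) (sym eq)
                           (level-increasing (0<split j) (split< j) (2len≤M j) i<s)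
    ... | inj₂ (eq , _) = contradiction (split< j) (≤⇒≯ (subst (_≤ split j) eq i<s))

    height-lower : ∀ {i k} → CyclicSuc i k → split j ≤ pos j i → height j k < height j i
    height-lower {i} {k} i↝k s≤i with Rotation.pos-suc α i↝k
    ... | inj₁ eq = subst (λ t → level t < height j i) (sym eq)
          (level-decreasing (0<split j) (split< j) (2len≤M j) s≤i (subst (_< len j) eq (Rotation.pos< α k)))
    -- The edge returning to `α`, which has height 0; `i` is higher, since its position is positive.
    ... | inj₂ (_ , eq) = subst (λ t → level t < height j i) (sym eq)
          (subst (_< height j i) (sym (level-< (0<split j))) (n≢0⇒n>0 λ h≡0 →
            contradiction (≤-trans (0<split j) (≤-trans s≤i (≤-reflexive
              (trans (cong (pos j) (height≡0⇒α h≡0)) (Rotation.pos-α α))))) λ ()))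

  open Joints

  consecutive : ∀ {j k} → toℕ k ≡ suc (toℕ j) → ∀ {i l} → vtx j i ≡ vtx k l →
                i ≡ β (joints j) × l ≡ α (joints k)
  consecutive {j} {k} k≡1+j {i} {l} eq =
      vtx-inj j (trans (Equivalence.to (meetAtB j k k≡1+j _) both) (sym (is-b (joints j) k≡1+j)))
    , vtx-inj k (trans (sym eq) (trans (Equivalence.to (meetAtA j k k≡1+j _) both)
                                       (sym (is-a (joints k) k≡1+j))))
    where
    both : vtx j i ∈ᶜ Z j × vtx j i ∈ᶜ Z k
    both = (i , refl) , (l , sym eq)

  joined : ∀ {j k} → toℕ k ≡ suc (toℕ j) → vtx j (β (joints j)) ≡ vtx k (α (joints k))
  joined {j} {k} k≡1+j = trans (is-b (joints j) k≡1+j) (trans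
    (Equivalence.to (meetAtA j k k≡1+j _) (Equivalence.from (meetAtB j k k≡1+j _) refl))
    (sym (is-a (joints k) k≡1+j)))

  -- Cycles at distance two or more are disjoint, and neighbours share only the joint on the block
  -- boundary. This makes `rank` independent of the cycle that `vertexUnion` picks.
  rankAt-< : ∀ {j k} → toℕ j < toℕ k → ∀ {i l} → vtx j i ≡ vtx k l → rankAt j i ≡ rankAt k l
  rankAt-< {j} {k} j<k {i} {l} eq with m≤n⇒m<n∨m≡n j<k
  ... | inj₁ 1+j<k = contradiction ((i , refl) , (l , sym eq)) (disjoint j k
          (subst (1 <_) (sym (m≤n⇒∣m-n∣≡n∸m (<⇒≤ j<k)))
            (m+n≤o⇒m≤o∸n 2 1+j<k)) _)
  ... | inj₂ 1+j≡k with consecutive (sym 1+j≡k) eq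
  ...   | refl , refl = trans rankAt-β (trans (cong (_* M) 1+j≡k) (sym rankAt-α))

  rankAt-cong : ∀ {j k i l} → vtx j i ≡ vtx k l → rankAt j i ≡ rankAt k l
  rankAt-cong {j} {k} eq with <-cmp (toℕ j) (toℕ k)
  ... | tri< j<k _ _ = rankAt-< j<k eq
  ... | tri> _ _ k<j = sym (rankAt-< k<j (sym eq))
  ... | tri≈ _ j≡k _ with Fin.toℕ-injective j≡k
  ...   | refl = cong (rankAt j) (vtx-inj j eq)

  rankAt-<⁻ : ∀ {j k} → toℕ j < toℕ k → ∀ {i l} → rankAt j i ≡ rankAt k l → vtx j i ≡ vtx k l
  rankAt-<⁻ {j} {k} j<k {i} {l} eq with block-≡ (toℕ j) (toℕ k) (0<M {j}) (height≤M i) eq j<k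
  ... | k≡1+j , h≡M , h≡0 =
    trans (cong (vtx j) (height≡M⇒β h≡M)) (trans (joined k≡1+j) (cong (vtx k) (sym (height≡0⇒α h≡0))))

  rankAt-injective : ∀ {j k i l} → rankAt j i ≡ rankAt k l → vtx j i ≡ vtx k l
  rankAt-injective {j} {k} eq with <-cmp (toℕ j) (toℕ k)
  ... | tri< j<k _ _ = rankAt-<⁻ j<k eq
  ... | tri> _ _ k<j = sym (rankAt-<⁻ k<j (sym eq))
  ... | tri≈ _ j≡k _ with Fin.toℕ-injective j≡k
  ...   | refl = cong (vtx j) (height-injective (+-cancelˡ-≡ (toℕ j * M) _ _ eq))

  rank : V → ℕ
  rank v = let j , i , _ = vertexUnion v in rankAt j i

  rank-vtx : ∀ j i → rank (vtx j i) ≡ rankAt j i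
  rank-vtx j i = rankAt-cong (proj₂ (proj₂ (vertexUnion (vtx j i))))

  rank-injective : Injective _≡_ _≡_ rank
  rank-injective {u} {v} eq =
    trans (sym (proj₂ (proj₂ (vertexUnion u)))) (trans (rankAt-injective eq) (proj₂ (proj₂ (vertexUnion v))))

  -- Arguments are ordered by rising rank. On the second arc this runs against the cyclic order,
  -- hence the exchanged ends in `lower`.
  data Arc : Bool → V → V → Set where
    upper : ∀ {j i k} → CyclicSuc i k → pos j i < split j → Arc true  (vtx j i) (vtx j k)
    lower : ∀ {j i k} → CyclicSuc i k → split j ≤ pos j i → Arc false (vtx j k) (vtx j i)

  vtx-< : ∀ {j k i l} → rank (vtx j i) < rank (vtx k l) → rankAt j i < rankAt k l
  vtx-< = subst₂ _<_ (rank-vtx _ _) (rank-vtx _ _)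

  arcs : ∀ {u v} → Adj u v → rank u < rank v → ∃[ c ] Arc c u v
  arcs {u} {v} adj u<v with Equivalence.to (edgeUnion u v) adj
  ... | j , i , k , i↝k , ends with pos j i <? split j | ends
  ...   | yes i<s | inj₁ (refl , refl) = true , upper i↝k i<s
  ...   | no  i≮s | inj₂ (refl , refl) = false , lower i↝k (≮⇒≥ i≮s)
  ...   | yes i<s | inj₂ (refl , refl) = contradiction (vtx-< u<v)
          (<-asym (+-monoʳ-< (toℕ j * M) (proj₂ (height-upper i↝k i<s))))
  ...   | no  i≮s | inj₁ (refl , refl) = contradiction (vtx-< u<v)
          (<-asym (+-monoʳ-< (toℕ j * M) (height-lower i↝k (≮⇒≥ i≮s))))

  sameBlock : ∀ {j k i i′ l l′} → rankAt j i < rankAt k l′ → rankAt k l < rankAt j i′ → j ≡ k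
  sameBlock {j} {k} {i′ = i′} {l′ = l′} p q = Fin.toℕ-injective
    (≤-antisym (block-≤ (toℕ j) (toℕ k) (height≤M l′) p) (block-≤ (toℕ k) (toℕ j) (height≤M i′) q))

  CyclicSuc-functional : ∀ {m} {i k l : Fin m} → CyclicSuc i k → CyclicSuc i l → k ≡ l
  CyclicSuc-functional (inj₁ p) (inj₁ q) = Fin.toℕ-injective (trans p (sym q))
  CyclicSuc-functional (inj₂ (_ , p)) (inj₂ (_ , q)) = Fin.toℕ-injective (trans p (sym q))
  CyclicSuc-functional {k = k} (inj₁ p) (inj₂ (q , _)) = contradiction (Fin.toℕ<n k) (<-irrefl (trans p q))
  CyclicSuc-functional {l = l} (inj₂ (q , _)) (inj₁ p) = contradiction (Fin.toℕ<n l) (<-irrefl (trans p q))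

  upper-disjoint : ∀ {j i i′ l} → CyclicSuc i i′ → pos j i < split j → pos j l < split j →
                   height j l < height j i′ → pos j l ≤ pos j i
  upper-disjoint {j} i↝i′ i<s l<s l<i′ = ≮⇒≥ λ i<l →
    let eq = proj₁ (height-upper {j} i↝i′ i<s)
        i′<s = subst (_< split j) (sym eq) (≤-<-trans i<l l<s)
    in <⇒≱ (subst₂ _<_ (level-< l<s) (level-< i′<s) l<i′) (subst (_≤ _) (sym eq) i<l)
    where open Level M (split j)

  lower-disjoint : ∀ {j i i′ l} → CyclicSuc i i′ → split j ≤ pos j i →
                   height j i′ < height j l → pos j l ≤ pos j i
  lower-disjoint {j} {i} {i′} {l} i↝i′ s≤i i′<l = ≮⇒≥ go
    where
    open Level M (split j)
    go : ¬ (pos j i < pos j l)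
    go i<l with Rotation.pos-suc (α (joints j)) i↝i′
    ... | inj₁ eq = <⇒≱ i′<l (level-antitone (0<split j) (split< j) (2len≤M j)
            (≤-trans s≤i (subst (pos j i ≤_) (sym eq) (n≤1+n _)))
            (subst (_≤ pos j l) (sym eq) i<l) (Rotation.pos< (α (joints j)) l))
    ... | inj₂ (eq , _) = contradiction (Rotation.pos< (α (joints j)) l) (≤⇒≯ (subst (_≤ pos j l) eq i<l))

  -- Intervals overlapping in more than an endpoint lie in one block. There the overlap bounds the
  -- position of each edge's cyclic start by that of the other, so the starts agree, and with them
  -- the edges.
  arcs-separated : ∀ {c u v u′ v′} → Arc c u v → Arc c u′ v′ →
                   rank u < rank v′ → rank u′ < rank v → u ≡ u′ × v ≡ v′
  arcs-separated (upper {j} {i} {k} i↝k i<s) (upper {j′} {i′} {k′} i′↝k′ i′<s) p q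
    with sameBlock {j} {j′} (vtx-< p) (vtx-< q)
  ... | refl with Rotation.pos-injective (α (joints j)) (≤-antisym
                    (upper-disjoint i′↝k′ i′<s i<s (+-cancelˡ-< (toℕ j * M) _ _ (vtx-< p)))
                    (upper-disjoint i↝k i<s i′<s (+-cancelˡ-< (toℕ j * M) _ _ (vtx-< q))))
  ...   | refl = refl , cong (vtx j) (CyclicSuc-functional i↝k i′↝k′)
  arcs-separated (lower {j} {i} {k} i↝k s≤i) (lower {j′} {i′} {k′} i′↝k′ s≤i′) p q
    with sameBlock {j} {j′} (vtx-< p) (vtx-< q)
  ... | refl with Rotation.pos-injective (α (joints j)) (≤-antisym
                    (lower-disjoint i′↝k′ s≤i′ (+-cancelˡ-< (toℕ j * M) _ _ (vtx-< q)))
                    (lower-disjoint i↝k s≤i (+-cancelˡ-< (toℕ j * M) _ _ (vtx-< p))))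
  ...   | refl = cong (vtx j) (CyclicSuc-functional i↝k i′↝k′) , refl

-- Ranks and arcs are pulled back along `f`, which keeps them injective and separated; `Layout` then
-- numbers `G` itself.
subchain⇒cutwidth≤2 : ∀ {n} (G H : Graph) → ChainOfCycles n H → IsomorphicToSubgraphOf G H → CutwidthAtMost G 2
subchain⇒cutwidth≤2 G H C (S , iso) = Layout.cutwidth≤2 G (rank ∘ f) (injective ∘ rank-injective)
  (λ c u v → Arc c (f u) (f v))
  (λ adj → arcs (Subgraph.E⊆Adj S (Equivalence.to (edges _ _) adj)))
  λ p q u<v′ u′<v → let eq , eq′ = arcs-separated p q u<v′ u′<v in injective eq , injective eq′
  where
  open ChainLayout H C
  open _≅_ iso

-- Growing chains of cycles

infix 4 _∈ᶜˢ_
_∈ᶜˢ_ : ∀ {L : Set} → L → List (Cycle L) → Set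
v ∈ᶜˢ Cs = Any (v ∈ᶜ_) Cs

-- Chains are grown at their first cycle; the index is the free joint of that cycle.
data IsChain {L : Set} : L → List (Cycle L) → Set where
  []     : ∀ {h} → IsChain h []
  attach : ∀ {x h C Cs} → x ∈ᶜ C → h ∈ᶜ C → x ≢ h →
           (∀ {v} → v ∈ᶜ C → v ∈ᶜˢ Cs → v ≡ h) → IsChain h Cs → IsChain x (C ∷ Cs)

module _ {L : Set} where

  entry exit : ∀ {h : L} {Cs} → IsChain h Cs → Fin (length Cs) → L
  entry (attach {x = x} _ _ _ _ _)  zero    = x
  entry (attach _ _ _ _ ch)         (suc j) = entry ch j
  exit  (attach {h = h} _ _ _ _ _)  zero    = h
  exit  (attach _ _ _ _ ch)         (suc j) = exit ch j

  entry∈ : ∀ {h : L} {Cs} (ch : IsChain h Cs) j → entry ch j ∈ᶜ lookup Cs j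
  entry∈ (attach x∈ _ _ _ _) zero    = x∈
  entry∈ (attach _ _ _ _ ch) (suc j) = entry∈ ch j

  exit∈ : ∀ {h : L} {Cs} (ch : IsChain h Cs) j → exit ch j ∈ᶜ lookup Cs j
  exit∈ (attach _ h∈ _ _ _) zero    = h∈
  exit∈ (attach _ _ _ _ ch) (suc j) = exit∈ ch j

  joint∉tail : ∀ {h : L} {C Cs} → IsChain h (C ∷ Cs) → ¬ h ∈ᶜˢ Cs
  joint∉tail (attach x∈ _ x≢h sep _) x∈Cs = x≢h (sep x∈ x∈Cs)

  ∈-lookupᶜ : ∀ {v : L} Cs j → v ∈ᶜ lookup Cs j → v ∈ᶜˢ Cs
  ∈-lookupᶜ Cs j = lose (∈-lookup j)

  -- A vertex of the first cycle that recurs behind the second must be the free joint of the second,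
  -- and `joint∉tail` keeps that joint off everything behind it.
  chain-disjoint : ∀ {h : L} {Cs} → IsChain h Cs → ∀ i j → ∣ toℕ i - toℕ j ∣ > 1 →
                   ∀ v → ¬ (v ∈ᶜ lookup Cs i × v ∈ᶜ lookup Cs j)
  chain-disjoint (attach _ _ _ _ _) zero zero () _ _
  chain-disjoint (attach {Cs = _ ∷ _} _ _ _ _ _) zero (suc zero) (s≤s ()) _ _
  chain-disjoint (attach {Cs = _ ∷ Cs} _ _ _ sep ch) zero (suc (suc j)) _ v (v∈C , v∈) =
    joint∉tail ch (subst (_∈ᶜˢ Cs) (sep v∈C (there (∈-lookupᶜ Cs j v∈))) (∈-lookupᶜ Cs j v∈))
  chain-disjoint (attach {Cs = _ ∷ _} _ _ _ _ _) (suc zero) zero (s≤s ()) _ _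
  chain-disjoint (attach {Cs = _ ∷ Cs} _ _ _ sep ch) (suc (suc j)) zero _ v (v∈ , v∈C) =
    joint∉tail ch (subst (_∈ᶜˢ Cs) (sep v∈C (there (∈-lookupᶜ Cs j v∈))) (∈-lookupᶜ Cs j v∈))
  chain-disjoint (attach _ _ _ _ ch) (suc i) (suc j) far v both = chain-disjoint ch i j far v both

  chain-meet : ∀ {h : L} {Cs} (ch : IsChain h Cs) i j → toℕ j ≡ suc (toℕ i) →
               exit ch i ≡ entry ch j × (∀ v → (v ∈ᶜ lookup Cs i × v ∈ᶜ lookup Cs j) ⇔ v ≡ exit ch i)
  chain-meet (attach _ h∈ _ sep ch@(attach h∈′ _ _ _ _)) zero (suc zero) _ = refl , λ v →
    mk⇔ (λ where (v∈ , v∈′) → sep v∈ (here v∈′)) (λ where refl → h∈ , h∈′)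
  chain-meet (attach _ _ _ _ ch) (suc i) (suc j) eq = chain-meet ch i j (suc-injective eq)
  chain-meet (attach {Cs = _ ∷ _} _ _ _ _ _) zero (suc (suc _)) ()
  chain-meet (attach _ _ _ _ _) zero zero ()
  chain-meet (attach _ _ _ _ _) (suc _) zero ()

  module _ {m : ℕ} (enumL : L ↔ Fin m) (_≟_ : DecidableEquality L) (Cs : List (Cycle L)) where

    edge? : ∀ (C : Cycle L) u v → Dec (CycleEdge C u v)
    edge? C u v = Fin.any? λ i → Fin.any? λ j →
      ((toℕ j ℕ.≟ suc (toℕ i)) ⊎-dec
        ((suc (toℕ i) ℕ.≟ len) ×-dec (toℕ j ℕ.≟ 0)))
      ×-dec (((vertex i ≟ u) ×-dec (vertex j ≟ v)) ⊎-dec ((vertex i ≟ v) ×-dec (vertex j ≟ u)))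
      where open Cycle C

    ¬CyclicSuc-refl : ∀ {k} → 3 ≤ k → (i : Fin k) → ¬ CyclicSuc i i
    ¬CyclicSuc-refl _ i (inj₁ eq) = 1+n≢n (sym eq)
    ¬CyclicSuc-refl 3≤k i (inj₂ (1+i≡k , i≡0)) =
      contradiction (subst (3 ≤_) (trans (sym 1+i≡k) (cong suc i≡0)) 3≤k) λ where (s≤s ())

    unionGraph : Graph
    unionGraph = record
      { V = L ; order = m ; enum = enumL
      ; Adj = λ u v → ∃[ j ] CycleEdge (lookup Cs j) u v
      ; adj? = λ u v → Fin.any? λ j → edge? (lookup Cs j) u v
      ; symm = λ where (j , i , k , i↝k , e) → j , i , k , i↝k , swap e
      ; irrefl = λ where
          v (j , i , k , i↝k , e) → ¬CyclicSuc-refl (Cycle.len≥3 (lookup Cs j)) i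
            (subst (CyclicSuc i) (sym (Cycle.injective (lookup Cs j) (ends e))) i↝k)
      }
      where
      ends : ∀ {v x y : L} → (x ≡ v × y ≡ v) ⊎ (x ≡ v × y ≡ v) → x ≡ y
      ends (inj₁ (p , q)) = trans p (sym q)
      ends (inj₂ (p , q)) = trans p (sym q)

    unionGraph-chain : ∀ {h} → IsChain h Cs → (∀ v → v ∈ᶜˢ Cs) → ChainOfCycles (length Cs) unionGraph
    unionGraph-chain ch cover = record
      { Z = lookup Cs ; a = entry ch ; b = exit ch
      ; a∈Z = entry∈ ch ; b∈Z = exit∈ ch
      ; vertexUnion = λ v → index (cover v) , lookup-index (cover v)
      ; edgeUnion = λ u v → mk⇔ id id
      ; disjoint = chain-disjoint ch
      ; meetAtB = λ i j eq → proj₂ (chain-meet ch i j eq)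
      ; meetAtA = λ i j eq v → subst (λ w → _ ⇔ v ≡ w) (proj₁ (chain-meet ch i j eq))
                                     (proj₂ (chain-meet ch i j eq) v)
      }

-- Paths as lists, and the cycles they close to

listCycle : ∀ {L : Set} (vs : List L) → Unique vs → 3 ≤ length vs → Cycle L
listCycle vs vs! 3≤ = record
  { len = length vs ; len≥3 = 3≤ ; vertex = lookup vs ; injective = lookup-injective vs! }

∈-listCycle⁺ : ∀ {L : Set} {vs : List L} vs! 3≤ {v} → v ∈ vs → v ∈ᶜ listCycle vs vs! 3≤
∈-listCycle⁺ _ _ v∈ = index v∈ , sym (lookup-index v∈)

∈-listCycle⁻ : ∀ {L : Set} {vs : List L} vs! 3≤ {v} → v ∈ᶜ listCycle vs vs! 3≤ → v ∈ vs
∈-listCycle⁻ _ _ (i , refl) = ∈-lookup i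

-- Inductive rather than by indices, so that prepending to a path and reversing it need no index
-- arithmetic.
data Step {L : Set} : List L → L → L → Set where
  here  : ∀ {u v vs} → Step (u ∷ v ∷ vs) u v
  there : ∀ {x u v vs} → Step vs u v → Step (x ∷ vs) u v

module _ {L : Set} where

  Link : List L → L → L → Set
  Link vs u v = Step vs u v ⊎ Step vs v u

  step-index : ∀ {vs : List L} {u v} → Step vs u v →
               ∃[ i ] ∃[ j ] toℕ j ≡ suc (toℕ i) × lookup vs i ≡ u × lookup vs j ≡ v
  step-index here = zero , suc zero , refl , refl , refl
  step-index (there s) = let i , j , eq , p , q = step-index s in suc i , suc j , cong suc eq , p , q

  step-∷ʳ : ∀ {vs : List L} {u v} x → Step vs u v → Step (vs ∷ʳ x) u v
  step-∷ʳ x here      = here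
  step-∷ʳ x (there s) = there (step-∷ʳ x s)

  step-last : ∀ (vs : List L) u v → Step ((vs ∷ʳ u) ∷ʳ v) u v
  step-last []           u v = here
  step-last (x ∷ vs)     u v = there (step-last vs u v)

  step-reverse : ∀ {vs : List L} {u v} → Step vs u v → Step (reverse vs) v u
  step-reverse {u ∷ v ∷ vs} here rewrite unfold-reverse u (v ∷ vs) | unfold-reverse v vs = step-last (reverse vs) v u
  step-reverse {x ∷ vs} (there s) rewrite unfold-reverse x vs = step-∷ʳ x (step-reverse s)

  link-edge : ∀ {vs : List L} vs! 3≤ {u v} → Link vs u v → CycleEdge (listCycle vs vs! 3≤) u v
  link-edge _ _ (inj₁ s) = let i , j , eq , p , q = step-index s in i , j , inj₁ eq , inj₁ (p , q)
  link-edge _ _ (inj₂ s) = let i , j , eq , p , q = step-index s in i , j , inj₁ eq , inj₂ (p , q)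

  last-index : ∀ (vs : List L) x → ∃[ i ] suc (toℕ i) ≡ length (vs ∷ʳ x) × lookup (vs ∷ʳ x) i ≡ x
  last-index []       x = zero , refl , refl
  last-index (_ ∷ vs) x = let i , eq , p = last-index vs x in suc i , cong suc eq , p

  closing-edge : ∀ {vs : List L} {x y ws} vs! 3≤ → vs ≡ ws ∷ʳ y → CycleEdge (listCycle (x ∷ vs) vs! 3≤) y x
  closing-edge {x = x} {ws = ws} _ _ refl =
    let i , eq , p = last-index (x ∷ ws) _ in i , zero , inj₂ (eq , refl) , inj₁ (p , refl)

  unique-reverse : ∀ {vs : List L} → Unique vs → Unique (reverse vs)
  unique-reverse {vs} = Permutation.Unique-resp-↭ (setoid L) (↭-sym (setoid L) (Permutation.↭-reverse (setoid L) vs))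

-- A chain of finished cycles together with a path which is to become the next cycle.
record Growth (L : Set) : Set where
  field
    done     : List (Cycle L)
    joint    : L
    chain    : IsChain joint done
    path     : List L
    p q      : L
    starts   : ∃[ vs ] path ≡ p ∷ vs
    stops    : ∃[ vs ] path ≡ vs ∷ʳ q
    joint∈   : joint ∈ path
    path!    : Unique path
    separate : ∀ {v} → v ∈ path → v ∈ᶜˢ done → v ≡ joint

  Used : L → Set
  Used v = v ∈ path ⊎ v ∈ᶜˢ done

  Linked : L → L → Set
  Linked u v = Link path u v ⊎ Any (λ C → CycleEdge C u v) done

module _ {L : Set} where
  open Growth

  infix 4 _⊑_
  record _⊑_ (B B′ : Growth L) : Set where
    field
      used⁺   : ∀ {v} → Used B v → Used B′ v
      linked⁺ : ∀ {u v} → Linked B u v → Linked B′ u v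
  open _⊑_ public

  ⊑-refl : ∀ {B} → B ⊑ B
  ⊑-refl = record { used⁺ = id ; linked⁺ = id }

  ⊑-trans : ∀ {B B′ B″} → B ⊑ B′ → B′ ⊑ B″ → B ⊑ B″
  ⊑-trans g h = record { used⁺ = used⁺ h ∘ used⁺ g ; linked⁺ = linked⁺ h ∘ linked⁺ g }

  singleton : L → Growth L
  singleton x = record
    { done = [] ; joint = x ; chain = [] ; path = x ∷ [] ; p = x ; q = x
    ; starts = [] , refl ; stops = [] , refl ; joint∈ = here refl ; path! = [] ∷ []
    ; separate = λ _ () }

  -- By this symmetry the path only ever has to be prolonged at its front `p`.
  flip : Growth L → Growth L
  flip B = record
    { done = done B ; joint = joint B ; chain = chain B ; path = reverse (path B)
    ; p = q B ; q = p B
    ; starts = let vs , eq = stops B in reverse vs , trans (cong reverse eq) (reverse-++ vs (q B ∷ []))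
    ; stops = let vs , eq = starts B in reverse vs , trans (cong reverse eq) (unfold-reverse (p B) vs)
    ; joint∈ = reverse⁺ (joint∈ B)
    ; path! = unique-reverse (path! B)
    ; separate = separate B ∘ reverse⁻ }

  flip-⊑ : ∀ B → B ⊑ flip B
  flip-⊑ B = record
    { used⁺ = map⊎ reverse⁺ id
    ; linked⁺ = map⊎ (λ l → swap (map⊎ step-reverse step-reverse l)) id }

  flip-used⁻ : ∀ B {v} → Used (flip B) v → Used B v
  flip-used⁻ B = map⊎ reverse⁻ id

  module _ (B : Growth L) (x : L) (x-new : ¬ Used B x) where

    x∷path! : Unique (x ∷ path B)
    x∷path! = All.¬Any⇒All¬ _ (x-new ∘ inj₁) ∷ path! B

    extend : Growth L
    extend = record
      { done = done B ; joint = joint B ; chain = chain B ; path = x ∷ path B ; p = x ; q = q B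
      ; starts = path B , refl
      ; stops = let vs , eq = stops B in x ∷ vs , cong (x ∷_) eq
      ; joint∈ = there (joint∈ B)
      ; path! = x∷path!
      ; separate = λ where
          (here refl) x∈ → contradiction (inj₂ x∈) x-new
          (there v∈)     → separate B v∈ }

    extend-⊑ : B ⊑ extend
    extend-⊑ = record { used⁺ = map⊎ there id ; linked⁺ = map⊎ (map⊎ there there) id }

    extend-used⁻ : ∀ {v} → Used extend v → v ≡ x ⊎ Used B v
    extend-used⁻ (inj₁ (here eq))  = inj₁ eq
    extend-used⁻ (inj₁ (there v∈)) = inj₂ (inj₁ v∈)
    extend-used⁻ (inj₂ v∈)         = inj₂ (inj₂ v∈)

    extend-linked : Linked extend (p B) x
    extend-linked with starts B
    ... | vs , refl = inj₁ (inj₂ here)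

    module _ (long : 2 ≤ length (path B)) where

      newCycle : Cycle L
      newCycle = listCycle (x ∷ path B) x∷path! (s≤s long)

      close : Growth L
      close = record
        { done = newCycle ∷ done B ; joint = x ; path = x ∷ [] ; p = x ; q = x
        ; chain = attach (∈-listCycle⁺ x∷path! (s≤s long) (here refl)) (∈-listCycle⁺ x∷path! (s≤s long) (there (joint∈ B)))
            (λ where refl → x-new (inj₁ (joint∈ B))) meet (chain B)
        ; starts = [] , refl ; stops = [] , refl
        ; joint∈ = here refl
        ; path! = [] ∷ []
        ; separate = λ where (here eq) _ → eq }
        where
        meet : ∀ {v} → v ∈ᶜ newCycle → v ∈ᶜˢ done B → v ≡ joint B
        meet v∈C v∈ with ∈-listCycle⁻ x∷path! (s≤s long) v∈C
        ... | here refl   = contradiction (inj₂ v∈) x-new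
        ... | there v∈path = separate B v∈path v∈

      close-⊑ : B ⊑ close
      close-⊑ = record
        { used⁺ = λ where
            (inj₁ v∈) → inj₂ (here (∈-listCycle⁺ x∷path! (s≤s long) (there v∈)))
            (inj₂ v∈) → inj₂ (there v∈)
        ; linked⁺ = λ where
            (inj₁ l) → inj₂ (here (link-edge x∷path! (s≤s long) (map⊎ there there l)))
            (inj₂ e) → inj₂ (there e) }

      close-used⁻ : ∀ {v} → Used close v → v ≡ x ⊎ Used B v
      close-used⁻ (inj₁ (here eq)) = inj₁ eq
      close-used⁻ (inj₂ (here v∈)) with ∈-listCycle⁻ x∷path! (s≤s long) v∈
      ... | here eq      = inj₁ eq
      ... | there v∈path = inj₂ (inj₁ v∈path)
      close-used⁻ (inj₂ (there v∈)) = inj₂ (inj₂ v∈)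

      close-linked-p : Linked close (p B) x
      close-linked-p = inj₂ (here (link-edge x∷path! (s≤s long) (inj₂ (step-p (starts B)))))
        where
        step-p : ∃[ vs ] path B ≡ p B ∷ vs → Step (x ∷ path B) x (p B)
        step-p (vs , eq) rewrite eq = here

      close-linked-q : Linked close (q B) x
      close-linked-q = inj₂ (here (closing-edge x∷path! (s≤s long) (proj₂ (stops B))))

  p≢q⇒long : ∀ (B : Growth L) → p B ≢ q B → 2 ≤ length (path B)
  p≢q⇒long B p≢q with path B | starts B | stops B
  ... | _ ∷ []     | [] , refl | [] , refl = contradiction refl p≢q
  ... | _ ∷ []     | [] , refl | _ ∷ [] , ()
  ... | _ ∷ []     | [] , refl | _ ∷ _ ∷ _ , ()
  ... | _ ∷ _ ∷ _  | _         | _ = s≤s (s≤s z≤n)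

  extend-long : ∀ B x new → 2 ≤ length (path (extend B x new))
  extend-long B x new with starts B
  ... | vs , refl = s≤s (s≤s z≤n)

  module _ (_≟_ : DecidableEquality L) (z : L) where

    used? : ∀ B v → Dec (Used B v)
    used? B v = Any.any? (v ≟_) (path B) ⊎-dec Any.any? (λ C → Fin.any? λ i → Cycle.vertex C i ≟ v) (done B)

    -- All labels are vertices of the final graph, so the leftovers are put on the path. Only `z` is
    -- held back, as the new vertex that closes the last cycle.
    record Filled (B : Growth L) (xs : List L) : Set where
      field
        result : Growth L
        grows  : B ⊑ result
        long   : 2 ≤ length (path result)
        z-new  : ¬ Used result z
        filled : ∀ {x} → x ∈ xs → x ≡ z ⊎ Used result x

    fill : ∀ B → 2 ≤ length (path B) → ¬ Used B z → ∀ xs → Filled B xs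
    fill B long z-new [] = record
      { result = B ; grows = ⊑-refl
      ; long = long ; z-new = z-new ; filled = λ () }
    fill B long z-new (x ∷ xs) with x ≟ z | used? B x
    ... | yes refl | _ = record { Filled F ; filled = λ where
            (here eq)  → inj₁ eq
            (there y∈) → Filled.filled F y∈ }
      where F = fill B long z-new xs
    ... | no _ | yes x-used = record { Filled F ; filled = λ where
            (here refl) → inj₂ (used⁺ (Filled.grows F) x-used)
            (there y∈)  → Filled.filled F y∈ }
      where F = fill B long z-new xs
    ... | no x≢z | no x-new = record { Filled F
          ; grows = ⊑-trans (extend-⊑ B x x-new) (Filled.grows F)
          ; filled = λ where
            (here refl) → inj₂ (used⁺ (Filled.grows F) (inj₁ (here refl)))
            (there y∈)  → Filled.filled F y∈ }
      where
      z-new′ : ¬ Used (extend B x x-new) z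
      z-new′ u with extend-used⁻ B x x-new u
      ... | inj₁ z≡x = x≢z (sym z≡x)
      ... | inj₂ u′  = z-new u′
      F = fill (extend B x x-new) (extend-long B x x-new) z-new′ xs

-- The sweep

module Sweep {n : ℕ} (E : Fin n → Fin n → Set) (E? : Decidable E) where

  Edge : Set
  Edge = Fin n × Fin n

  Crossing : ℕ → Edge → Set
  Crossing i (x , y) = E x y × toℕ x < i × i ≤ toℕ y

  -- Besides the vertices, a spare label for the start, one for each step, and two for the end.
  Label : Set
  Label = Fin n ⊎ Fin (3 + n)

  open Growth

  Carries : ℕ → Label → Maybe Edge → Set
  Carries i l s = ∀ {x y} → s ≡ just (x , y) → l ≡ inj₁ x × Crossing i (x , y)

  -- The edges leaving the first i vertices are carried by the two ends of the growing path, at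
  -- most one by each.
  record State (i : ℕ) : Set where
    field
      B        : Growth Label
      s t      : Maybe Edge
      atP      : Carries i (p B) s
      atQ      : Carries i (q B) t
      differ   : ∀ {e} → s ≡ just e → t ≢ just e
      complete : ∀ {e} → Crossing i e → s ≡ just e ⊎ t ≡ just e
      linked   : ∀ {x y} → E x y → toℕ x < toℕ y → toℕ y < i → Linked B (inj₁ x) (inj₁ y)
      fresh₁   : ∀ {x} → i ≤ toℕ x → ¬ Used B (inj₁ x)
      fresh₂   : ∀ {d} → i < toℕ d → ¬ Used B (inj₂ d)
  open State

  flipState : ∀ {i} → State i → State i
  flipState S = record
    { B = flip (B S) ; s = t S ; t = s S ; atP = atQ S ; atQ = atP S
    ; differ = λ t≡ s≡ → differ S s≡ t≡
    ; complete = swap ∘ complete S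
    ; linked = λ e x<y y<i → linked⁺ (flip-⊑ (B S)) (linked S e x<y y<i)
    ; fresh₁ = λ i≤ → fresh₁ S i≤ ∘ flip-used⁻ (B S)
    ; fresh₂ = λ i< → fresh₂ S i< ∘ flip-used⁻ (B S) }

  initial : State 0
  initial = record
    { B = singleton (inj₂ zero) ; s = nothing ; t = nothing
    ; atP = λ () ; atQ = λ () ; differ = λ ()
    ; complete = λ where (_ , () , _)
    ; linked = λ _ _ ()
    ; fresh₁ = λ where _ (inj₁ (here ())) ; _ (inj₁ (there ())) ; _ (inj₂ ())
    ; fresh₂ = λ where () (inj₁ (here refl)) ; _ (inj₁ (there ())) ; _ (inj₂ ()) }

  -- Vacuously true of a free end: that end may also be linked to the next vertex, at worst by an
  -- edge that the subgraph leaves out.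
  Ending : ℕ → Maybe Edge → Set
  Ending i s = ∀ {x y} → s ≡ just (x , y) → toℕ y ≡ i

  status : ∀ {i l} s → Carries i l s → (∃[ e ] s ≡ just e × Crossing (suc i) e) ⊎ Ending i s
  status nothing _ = inj₂ λ ()
  status {i} (just (x , y)) carries with toℕ y ℕ.≟ i | proj₂ (carries refl)
  ... | yes y≡i | _ = inj₂ λ where refl → y≡i
  ... | no  y≢i | E-xy , x<i , i≤y =
        inj₁ ((x , y) , refl , E-xy , m<n⇒m<1+n x<i , ≤∧≢⇒< i≤y (y≢i ∘ sym))

  one-slot : ∀ {es : List Edge} → length es ≤ 1 →
             ∃[ s ] (∀ {e} → s ≡ just e → e ∈ es) × (∀ {e} → e ∈ es → s ≡ just e)
  one-slot {[]}    _ = nothing , (λ ()) , (λ ())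
  one-slot {e ∷ []} _ = just e , (λ where refl → here refl) , (λ where (here refl) → refl)
  one-slot {_ ∷ _ ∷ _} (s≤s ())

  two-slots : ∀ {es : List Edge} → Unique es → length es ≤ 2 → ∃[ s ] ∃[ t ]
              (∀ {e} → s ≡ just e → e ∈ es) × (∀ {e} → t ≡ just e → e ∈ es) ×
              (∀ {e} → s ≡ just e → t ≢ just e) × (∀ {e} → e ∈ es → s ≡ just e ⊎ t ≡ just e)
  two-slots {[]} _ _ = nothing , nothing , (λ ()) , (λ ()) , (λ ()) , λ ()
  two-slots {e ∷ []} _ _ = just e , nothing , (λ where refl → here refl) , (λ ()) , (λ _ ()) ,
    λ where (here refl) → inj₁ refl
  two-slots {e ∷ e′ ∷ []} ((e≢e′ ∷ []) ∷ _) _ = just e , just e′ ,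
    (λ where refl → here refl) , (λ where refl → there (here refl)) ,
    (λ where refl eq → e≢e′ (sym (just-injective eq))) ,
    λ where (here refl) → inj₁ refl ; (there (here refl)) → inj₂ refl
  two-slots {_ ∷ _ ∷ _ ∷ _} _ (s≤s (s≤s ()))

  record Completed : Set where
    field
      {joint′}  : Label
      cycles    : List (Cycle Label)
      nonempty  : 1 ≤ length cycles
      isChain   : IsChain joint′ cycles
      covered   : ∀ l → l ∈ᶜˢ cycles
      edgesIn   : ∀ {x y} → E x y → toℕ x < toℕ y → ∃[ j ] CycleEdge (lookup cycles j) (inj₁ x) (inj₁ y)

  _≟ᴸ_ : DecidableEquality Label
  _≟ᴸ_ = ⊎-≡-dec Fin._≟_ Fin._≟_

  module _ (capacity : ∀ {i es} → Unique es → All (Crossing i) es → length es ≤ 2) where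

    module _ {i : ℕ} (i<n : i < n) where

      v : Fin n
      v = fromℕ< i<n

      v≡i : toℕ v ≡ i
      v≡i = Fin.toℕ-fromℕ< i<n

      ≡v : ∀ {y} → toℕ y ≡ i → y ≡ v
      ≡v eq = Fin.toℕ-injective (trans eq (sym v≡i))

      forward : List Edge
      forward = map (v ,_) (filter (λ y → E? v y ×-dec (suc i ≤? toℕ y)) (allFin n))

      forward! : Unique forward
      forward! = Unique.map⁺ ,-injectiveʳ (Unique.filter⁺ _ (Unique.allFin⁺ n))

      ∈-forward⁺ : ∀ {y} → E v y → suc i ≤ toℕ y → (v , y) ∈ forward
      ∈-forward⁺ e i<y = ∈-map⁺ (v ,_) (∈-filter⁺ _ (∈-allFin _) (e , i<y))

      ∈-forward⁻ : ∀ {x y} → (x , y) ∈ forward → x ≡ v × Crossing (suc i) (x , y)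
      ∈-forward⁻ e∈ with ∈-map⁻ (v ,_) e∈
      ... | y , y∈ , refl with ∈-filter⁻ _ {xs = allFin n} y∈
      ...   | _ , E-vy , i<y = refl , E-vy , s≤s (≤-reflexive v≡i) , i<y

      crossing-suc : ∀ {e} → Crossing (suc i) e → e ∈ forward ⊎ Crossing i e
      crossing-suc {x , y} (E-xy , s≤s x≤i , i<y) with m≤n⇒m<n∨m≡n x≤i
      ... | inj₁ x<i = inj₂ (E-xy , x<i , <⇒≤ i<y)
      ... | inj₂ x≡i with ≡v x≡i
      ...   | refl = inj₁ (∈-forward⁺ E-xy i<y)

      crossing≢forward : ∀ {e} → Crossing i e → ¬ e ∈ forward
      crossing≢forward (_ , x<i , _) e∈ with ∈-forward⁻ e∈
      ... | refl , _ = <-irrefl v≡i x<i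

      -- Edges that cross before `v` start earlier than `v`, so they are distinct from the forward
      -- edges; all of them together cross the cut after `v`.
      forward-capacity : ∀ es → Unique es → All (Crossing i) es → All (Crossing (suc i)) es →
                         length forward + length es ≤ 2
      forward-capacity es es! old new = subst (_≤ 2) (length-++ forward)
        (capacity {suc i} (Unique.++⁺ forward! es! λ where (e∈ , e∈′) → crossing≢forward (All.lookup old e∈′) e∈)
          (All.++⁺ (All.tabulate (proj₂ ∘ ∈-forward⁻)) new))

      module _ (S : State i) where

        -- The only new edges to realise are those with later end `v`. They cross the cut before
        -- `v`, so an end of the path carries each of them.
        linked-suc : ∀ B′ → B S ⊑ B′ →
          (∀ {x} → s S ≡ just (x , v) → Linked B′ (inj₁ x) (inj₁ v)) →
          (∀ {x} → t S ≡ just (x , v) → Linked B′ (inj₁ x) (inj₁ v)) →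
          ∀ {x y} → E x y → toℕ x < toℕ y → toℕ y < suc i → Linked B′ (inj₁ x) (inj₁ y)
        linked-suc B′ grows viaP viaQ e x<y (s≤s y≤i) with m≤n⇒m<n∨m≡n y≤i
        ... | inj₁ y<i = linked⁺ grows (linked S e x<y y<i)
        ... | inj₂ y≡i with ≡v y≡i
        ...   | refl with complete S (e , subst (_ <_) v≡i x<y , ≤-reflexive (sym v≡i))
        ...     | inj₁ s≡ = viaP s≡
        ...     | inj₂ t≡ = viaQ t≡

        v-new : ¬ Used (B S) (inj₁ v)
        v-new = fresh₁ S (≤-reflexive (sym v≡i))

        skip : ∀ {e e′} → s S ≡ just e → Crossing (suc i) e → t S ≡ just e′ → Crossing (suc i) e′ →
               State (suc i)
        skip {e} {e′} s≡ ce t≡ ce′ = record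
          { B = B S ; s = s S ; t = t S
          ; atP = λ eq → proj₁ (atP S eq) , subst (Crossing (suc i)) (just-injective (trans (sym s≡) eq)) ce
          ; atQ = λ eq → proj₁ (atQ S eq) , subst (Crossing (suc i)) (just-injective (trans (sym t≡) eq)) ce′
          ; differ = differ S
          ; complete = λ c → case (crossing-suc c)
          ; linked = linked-suc (B S) ⊑-refl
              (λ eq → passes ce (just-injective (trans (sym s≡) eq)))
              (λ eq → passes ce′ (just-injective (trans (sym t≡) eq)))
          ; fresh₁ = fresh₁ S ∘ <⇒≤
          ; fresh₂ = fresh₂ S ∘ <-trans (n<1+n i) }
          where
          no-forward : forward ≡ []
          no-forward with forward | forward-capacity (e ∷ e′ ∷ [])
                            (((λ where refl → differ S s≡ t≡) ∷ []) ∷ [] ∷ [])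
                            (proj₂ (atP S s≡) ∷ proj₂ (atQ S t≡) ∷ []) (ce ∷ ce′ ∷ [])
          ... | []    | _ = refl
          ... | _ ∷ f | le with m+n≤o⇒n≤o (length f) (≤-pred le)
          ...   | s≤s ()
          case : ∀ {e} → e ∈ forward ⊎ Crossing i e → s S ≡ just e ⊎ t S ≡ just e
          case (inj₁ e∈) = contradiction (subst (_ ∈_) no-forward e∈) λ ()
          case (inj₂ c)  = complete S c
          passes : ∀ {e x} {A : Set} → Crossing (suc i) e → e ≡ (x , v) → A
          passes (_ , _ , i<v) refl = contradiction i<v (<-irrefl (sym v≡i))

        -- The passing edge leaves one place in the cut after `v`, so at most one edge starts at
        -- `v`, and the new end `v` can carry it. The end `q` keeps its edge.
        prolong : Ending i (s S) → ∀ {e} → t S ≡ just e → Crossing (suc i) e → State (suc i)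
        prolong ending {e} t≡ ce = record
          { B = B′ ; s = s′ ; t = t S
          ; atP = λ eq → let x≡v , c = ∈-forward⁻ (s′⇒ eq) in cong inj₁ (sym x≡v) , c
          ; atQ = λ eq → proj₁ (atQ S eq) , subst (Crossing (suc i)) (just-injective (trans (sym t≡) eq)) ce
          ; differ = λ s′≡ t≡′ → crossing≢forward (proj₂ (atQ S t≡′)) (s′⇒ s′≡)
          ; complete = λ c → case c (crossing-suc c)
          ; linked = linked-suc B′ (extend-⊑ (B S) _ v-new)
              (λ eq → subst (λ l → Linked B′ l (inj₁ v)) (proj₁ (atP S eq)) (extend-linked (B S) _ v-new))
              (λ eq → contradiction (proj₂ (proj₂ (subst (Crossing (suc i)) (just-injective (trans (sym t≡) eq)) ce)))
                                    (<-irrefl (sym v≡i)))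
          ; fresh₁ = λ i<x u → fresh₁′ i<x (extend-used⁻ (B S) _ v-new u)
          ; fresh₂ = λ i<d u → fresh₂′ i<d (extend-used⁻ (B S) _ v-new u) }
          where
          B′ = extend (B S) (inj₁ v) v-new
          slot = one-slot {forward} (+-cancelʳ-≤ 1 _ 1 (forward-capacity (e ∷ []) ([] ∷ [])
                   (proj₂ (atQ S t≡) ∷ []) (ce ∷ [])))
          s′ = proj₁ slot
          s′⇒ = proj₁ (proj₂ slot)
          case : ∀ {e} → Crossing (suc i) e → e ∈ forward ⊎ Crossing i e → s′ ≡ just e ⊎ t S ≡ just e
          case _ (inj₁ e∈) = inj₁ (proj₂ (proj₂ slot) e∈)
          case (_ , _ , i<y) (inj₂ c) with complete S c
          ... | inj₁ s≡ = contradiction i<y (<-irrefl (sym (ending s≡)))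
          ... | inj₂ t≡ = inj₂ t≡
          fresh₁′ : ∀ {x} → suc i ≤ toℕ x → ¬ (inj₁ x ≡ inj₁ v ⊎ Used (B S) (inj₁ x))
          fresh₁′ i<x (inj₁ refl) = <-irrefl (sym v≡i) i<x
          fresh₁′ i<x (inj₂ u)    = fresh₁ S (<⇒≤ i<x) u
          fresh₂′ : ∀ {d} → suc i < toℕ d → ¬ (inj₂ d ≡ inj₁ v ⊎ Used (B S) (inj₂ d))
          fresh₂′ i<d (inj₂ u) = fresh₂ S (<-trans (n<1+n i) i<d) u

        -- B⁺ is B S, or B S prolonged by a spare label to make the new cycle long enough.
        closeAt : Ending i (s S) → Ending i (t S) → ∀ B⁺ → B S ⊑ B⁺ →
                  (∀ {l} → Used B⁺ l → (∃[ d ] l ≡ inj₂ d × toℕ d ≡ suc i) ⊎ Used (B S) l) →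
                  2 ≤ length (path B⁺) →
                  (∀ {e} → s S ≡ just e → p B⁺ ≡ p (B S)) → (∀ {e} → t S ≡ just e → q B⁺ ≡ q (B S)) →
                  State (suc i)
        closeAt s-ends t-ends B⁺ grows used⁻ long p≡ q≡ = record
          { B = B′ ; s = s′ ; t = t′
          ; atP = λ eq → let x≡v , c = ∈-forward⁻ (s′⇒ eq) in cong inj₁ (sym x≡v) , c
          ; atQ = λ eq → let x≡v , c = ∈-forward⁻ (t′⇒ eq) in cong inj₁ (sym x≡v) , c
          ; differ = differ′
          ; complete = λ c → case c (crossing-suc c)
          ; linked = linked-suc B′ (⊑-trans grows (close-⊑ B⁺ _ new long))
              (λ eq → subst (λ l → Linked B′ l (inj₁ v)) (trans (p≡ eq) (proj₁ (atP S eq)))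
                            (close-linked-p B⁺ _ new long))
              (λ eq → subst (λ l → Linked B′ l (inj₁ v)) (trans (q≡ eq) (proj₁ (atQ S eq)))
                            (close-linked-q B⁺ _ new long))
          ; fresh₁ = λ i<x u → fresh₁′ i<x (close-used⁻ B⁺ _ new long u)
          ; fresh₂ = λ i<d u → fresh₂′ i<d (close-used⁻ B⁺ _ new long u) }
          where
          new : ¬ Used B⁺ (inj₁ v)
          new u with used⁻ u
          ... | inj₂ u′ = v-new u′
          B′ = close B⁺ (inj₁ v) new long
          -- The new path is `v` alone; being both of its ends, it can carry two forward edges.
          slots = two-slots forward! (subst (_≤ 2) (+-identityʳ _) (forward-capacity [] [] [] []))
          s′ = proj₁ slots
          t′ = proj₁ (proj₂ slots)
          s′⇒ = proj₁ (proj₂ (proj₂ slots))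
          t′⇒ = proj₁ (proj₂ (proj₂ (proj₂ slots)))
          differ′ = proj₁ (proj₂ (proj₂ (proj₂ (proj₂ slots))))
          case : ∀ {e} → Crossing (suc i) e → e ∈ forward ⊎ Crossing i e → s′ ≡ just e ⊎ t′ ≡ just e
          case _ (inj₁ e∈) = proj₂ (proj₂ (proj₂ (proj₂ (proj₂ slots)))) e∈
          case (_ , _ , i<y) (inj₂ c) with complete S c
          ... | inj₁ s≡ = contradiction i<y (<-irrefl (sym (s-ends s≡)))
          ... | inj₂ t≡ = contradiction i<y (<-irrefl (sym (t-ends t≡)))
          fresh₁′ : ∀ {x} → suc i ≤ toℕ x → ¬ (inj₁ x ≡ inj₁ v ⊎ Used B⁺ (inj₁ x))
          fresh₁′ i<x (inj₁ refl) = <-irrefl (sym v≡i) i<x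
          fresh₁′ i<x (inj₂ u) with used⁻ u
          ... | inj₂ u′ = fresh₁ S (<⇒≤ i<x) u′
          fresh₂′ : ∀ {d} → suc i < toℕ d → ¬ (inj₂ d ≡ inj₁ v ⊎ Used B⁺ (inj₂ d))
          fresh₂′ i<d (inj₂ u) with used⁻ u
          ... | inj₁ (_ , refl , d≡) = <-irrefl (sym d≡) i<d
          ... | inj₂ u′ = fresh₂ S (<-trans (n<1+n i) i<d) u′

        -- Label 0 is spent on the initial path, so step `i` owns label `suc i`.
        spare : Fin (3 + n)
        spare = fromℕ< (m<n⇒m<1+n (m<n⇒m<1+n (s≤s i<n)))

        spare≡ : toℕ spare ≡ suc i
        spare≡ = Fin.toℕ-fromℕ< (m<n⇒m<1+n (m<n⇒m<1+n (s≤s i<n)))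

        -- The path may be a single vertex. The spare goes to the end that carries no edge, so the
        -- carried edge at `q` still reaches `v` when the cycle closes.
        closeWithSpare : s S ≡ nothing → Ending i (t S) → State (suc i)
        closeWithSpare s≡ t-ends = closeAt (λ eq → contradiction (trans (sym s≡) eq) λ ()) t-ends
          (extend (B S) _ new) (extend-⊑ (B S) _ new) used⁻ (extend-long (B S) _ new)
          (λ eq → contradiction (trans (sym s≡) eq) λ ()) (λ _ → refl)
          where
          new : ¬ Used (B S) (inj₂ spare)
          new = fresh₂ S (≤-reflexive (sym spare≡))
          used⁻ : ∀ {l} → Used (extend (B S) (inj₂ spare) new) l →
                  (∃[ d ] l ≡ inj₂ d × toℕ d ≡ suc i) ⊎ Used (B S) l
          used⁻ u with extend-used⁻ (B S) _ new u
          ... | inj₁ eq = inj₁ (spare , eq , spare≡)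
          ... | inj₂ u′ = inj₂ u′

        closeBoth : ∀ {e e′} → s S ≡ just e → t S ≡ just e′ → Ending i (s S) → Ending i (t S) →
                    State (suc i)
        closeBoth s≡ t≡ s-ends t-ends = closeAt s-ends t-ends (B S)
          ⊑-refl inj₂ (p≢q⇒long (B S) p≢q)
          (λ _ → refl) (λ _ → refl)
          where
          -- With equal ends both edges would join the same vertex to `v`, against `differ`.
          p≢q : p (B S) ≢ q (B S)
          p≢q eq = differ S s≡ (trans t≡ (cong just (sym (cong₂ _,_
            (inj₁-injective (trans (sym (proj₁ (atP S s≡))) (trans eq (proj₁ (atQ S t≡)))))
            (Fin.toℕ-injective (trans (s-ends s≡) (sym (t-ends t≡))))))))

      advance : State i → State (suc i)
      advance S with status (s S) (atP S) | status (t S) (atQ S)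
      ... | inj₁ (_ , s≡ , c) | inj₁ (_ , t≡ , c′) = skip S s≡ c t≡ c′
      ... | inj₁ (_ , s≡ , c) | inj₂ t-ends = prolong (flipState S) t-ends s≡ c
      ... | inj₂ s-ends | inj₁ (_ , t≡ , c) = prolong S s-ends t≡ c
      ... | inj₂ s-ends | inj₂ t-ends with s S in s≡ | t S in t≡
      ...   | nothing | _       = closeWithSpare S s≡ (t-ends ∘ trans (sym t≡))
      ...   | just _  | nothing = closeWithSpare (flipState S) t≡ (s-ends ∘ trans (sym s≡))
      ...   | just _  | just _  = closeBoth S s≡ t≡ (s-ends ∘ trans (sym s≡)) (t-ends ∘ trans (sym t≡))

    sweep : ∀ {i} → i ≤ n → State i
    sweep {zero}  _   = initial
    sweep {suc i} i<n = advance i<n (sweep (<⇒≤ i<n))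

    completed : Completed
    completed = record
      { cycles = done B₃ ; nonempty = s≤s z≤n ; isChain = chain B₃ ; covered = covered ; edgesIn = edgesIn }
      where
      S = sweep ≤-refl
      -- The sweep spends spare labels up to `n` only. Of the two beyond, `y` makes the path have at
      -- least two vertices, and `z` closes it.
      y z : Fin (3 + n)
      y = fromℕ< {suc n} (n≤1+n (2 + n))
      z = fromℕ< {suc (suc n)} ≤-refl
      y≡ : toℕ y ≡ suc n
      y≡ = Fin.toℕ-fromℕ< (n≤1+n (2 + n))
      z≡ : toℕ z ≡ suc (suc n)
      z≡ = Fin.toℕ-fromℕ< {suc (suc n)} ≤-refl
      y-new : ¬ Used (B S) (inj₂ y)
      y-new = fresh₂ S (≤-reflexive (sym y≡))
      B₁ = extend (B S) (inj₂ y) y-new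
      z-new : ¬ Used B₁ (inj₂ z)
      z-new u with extend-used⁻ (B S) _ y-new u
      ... | inj₁ eq = 1+n≢n (trans (sym z≡) (trans (cong toℕ (inj₂-injective eq)) y≡))
      ... | inj₂ u′ = fresh₂ S (subst (n <_) (sym z≡) (m<n⇒m<1+n (n<1+n n))) u′
      labels = map inj₁ (allFin n) ++ map inj₂ (allFin (3 + n))
      ∈-labels : ∀ l → l ∈ labels
      ∈-labels (inj₁ x) = ∈-++⁺ˡ (∈-map⁺ inj₁ (∈-allFin x))
      ∈-labels (inj₂ d) = ∈-++⁺ʳ (map inj₁ (allFin n)) (∈-map⁺ inj₂ (∈-allFin d))
      F = fill _≟ᴸ_ (inj₂ z) B₁ (extend-long (B S) _ y-new) z-new labels
      open Filled F renaming (result to B₂; z-new to z-new₂)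
      B₃ = close B₂ (inj₂ z) z-new₂ long
      B₂⊑B₃ = close-⊑ B₂ (inj₂ z) z-new₂ long
      covered : ∀ l → l ∈ᶜˢ done B₃
      covered l with filled (∈-labels l)
      ... | inj₁ refl = here (zero , refl)
      ... | inj₂ u with used⁺ B₂⊑B₃ u
      ...   | inj₁ (here refl) = here (zero , refl)
      ...   | inj₂ l∈ = l∈
      edgesIn : ∀ {x y} → E x y → toℕ x < toℕ y → ∃[ j ] CycleEdge (lookup (done B₃) j) (inj₁ x) (inj₁ y)
      edgesIn {y = y} e x<y with linked⁺ (⊑-trans (extend-⊑ (B S) _ y-new) (⊑-trans grows B₂⊑B₃))
                             (linked S e x<y (Fin.toℕ<n y))
      -- The path left after the last closing is a single label and has no links, so every edge is
      -- found on a finished cycle.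
      ... | inj₁ (inj₁ (there ()))
      ... | inj₁ (inj₂ (there ()))
      ... | inj₂ e∈ = index e∈ , lookup-index e∈

-- From the sweep to the equivalence

homomorphism⇒subgraph : ∀ (G H : Graph) (f : Graph.V G → Graph.V H) → (∀ {u v} → f u ≡ f v → u ≡ v) →
  (∀ {u v} → Graph.Adj G u v → Graph.Adj H (f u) (f v)) → IsomorphicToSubgraphOf G H
homomorphism⇒subgraph G H f f-injective f-hom =
  record
    { InV = λ w → ∃[ v ] f v ≡ w
    -- The image of the edges, not the induced subgraph: `H` may have further edges between image
    -- vertices.
    ; InE = λ x y → ∃[ u ] ∃[ v ] Adj u v × f u ≡ x × f v ≡ y
    ; E-sym = λ where (u , v , e , p , q) → v , u , symm e , q , p
    ; E⊆Adj = λ where (_ , _ , e , refl , refl) → f-hom e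
    ; E-endsˡ = λ where (u , _ , _ , p , _) → u , p }
  , record
    { f = f
    ; injective = f-injective
    ; image = λ w → mk⇔ id id
    ; edges = λ u v → mk⇔ (λ e → u , v , e , refl , refl)
        (λ where (_ , _ , e , p , q) → subst₂ Adj (f-injective p) (f-injective q) e) }
  where open Graph G

cutwidth≤2⇒subchain : ∀ G → CutwidthAtMost G 2 → ∃[ H ] (IsChainOfCycles H × IsomorphicToSubgraphOf G H)
cutwidth≤2⇒subchain G (π , cuts) =
  H , (length cycles , nonempty , unionGraph-chain labels↔ _≟ᴸ_ cycles isChain covered)
    , homomorphism⇒subgraph G H (inj₁ ∘ to) (to-injective π ∘ inj₁-injective) hom
  where
  open Graph G
  open Inverse π
  E : Fin order → Fin order → Set
  E x y = Adj (from x) (from y)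
  open Sweep E (λ x y → adj? (from x) (from y))

  -- A crossing edge forces `0 < i < order`, the range in which `cuts` gives a bound; there the
  -- edges pull back along `π` to distinct entries of the list that `cutSize` measures.
  capacity : ∀ {i es} → Unique es → All (Crossing i) es → length es ≤ 2
  capacity {es = []} _ _ = z≤n
  capacity {zero} {_ ∷ _} _ ((_ , () , _) ∷ _)
  capacity {i@(suc _)} {es@((_ , y) ∷ _)} es! cross@((_ , _ , i≤y) ∷ _) = begin
    length es                ≡⟨ length-map pull es ⟨
    length (map pull es)     ≤⟨ length-mono-⊆ (Unique.map⁺ pull-injective es!) crosses ⟩
    cutSize G π i            ≤⟨ cuts i (s≤s z≤n) (≤-<-trans i≤y (Fin.toℕ<n y)) ⟩
    2                        ∎
    where
    open ≤-Reasoning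
    pull : Edge → V × V
    pull (x , y) = from x , from y
    pull-injective : ∀ {e e′} → pull e ≡ pull e′ → e ≡ e′
    pull-injective eq = cong₂ _,_ (from-injective π (cong proj₁ eq)) (from-injective π (cong proj₂ eq))
    toℕ-to : ∀ x → toℕ (to (from x)) ≡ toℕ x
    toℕ-to x = cong toℕ (strictlyInverseˡ x)
    crosses : map pull es ⊆ filter (crosses? G π i) (cartesianProduct vertices vertices)
    crosses e∈ with ∈-map⁻ pull e∈
    ... | (x , y) , xy∈ , refl with All.lookup cross xy∈
    ...   | adj , x<i , i≤y = ∈-filter⁺ (crosses? G π i)
            (∈-cartesianProduct⁺ (∈-vertices G _) (∈-vertices G _))
            (adj , subst (_< i) (sym (toℕ-to x)) x<i , s≤s (subst (i ≤_) (sym (toℕ-to y)) i≤y))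

  open Completed (completed capacity)
  labels↔ = ↔-sym Fin.+↔⊎
  H = unionGraph labels↔ _≟ᴸ_ cycles

  hom : ∀ {u v} → Adj u v → Graph.Adj H (inj₁ (to u)) (inj₁ (to v))
  hom {u} {v} adj with <-cmp (toℕ (to u)) (toℕ (to v))
    | subst₂ Adj (sym (strictlyInverseʳ u)) (sym (strictlyInverseʳ v)) adj
  ... | tri< u<v _ _ | e = edgesIn e u<v
  ... | tri> _ _ v<u | e = Graph.symm H (edgesIn (symm e) v<u)
  ... | tri≈ _ u≡v _ | _ = contradiction (subst (Adj u) (sym (to-injective π (Fin.toℕ-injective u≡v))) adj) (irrefl u)

mainTheorem1 : (G : Graph) → CutwidthAtMost G 2 ⇔ (∃[ H ] (IsChainOfCycles H × IsomorphicToSubgraphOf G H))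
mainTheorem1 G = mk⇔ (cutwidth≤2⇒subchain G) λ where
  (H , (_ , _ , chain) , sub) → subchain⇒cutwidth≤2 G H chain sub
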